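{- For every $n\ge0$, $$\widetilde{Q}_n(x_1,x_2,y_1,y_2,u_1,u_2,v_1,v_2,\mathbf{w})=Q^{(1)}_n(x_1,x_2,y_1,y_2,u_1,u_2,v_1,v_2,\mathbf{w}),$$ where $$\widetilde{Q}_n(x_1,x_2,\widetilde{y}_1,y_2,u_1,u_2,\widetilde{v}_1,v_2,\mathbf{w})=\sum_{\sigma\in\mathfrak{S}_n} x_1^{\mathrm{eareccpeak}(\sigma)}x_2^{\mathrm{eareccdfall}(\sigma)}\widetilde{y}_1^{\mathrm{minval}(\sigma)}y_2^{\mathrm{ereccdrise}(\sigma)}u_1^{\mathrm{nrcpeak}(\sigma)}u_2^{\mathrm{nrcdfall}(\sigma)}\widetilde{v}_1^{\mathrm{nminval}(\sigma)}v_2^{\mathrm{nrcdrise}(\sigma)}\mathbf{w}^{\mathbf{fix}(\sigma)}$$ and $$Q^{(1)}_n(x_1,x_2,y_1,y_2,u_1,u_2,v_1,v_2,\mathbf{w})=\sum_{\sigma\in\mathfrak{S}_n} x_1^{\mathrm{eareccpeak}(\sigma)}x_2^{\mathrm{eareccdfall}(\sigma)}y_1^{\mathrm{ereccval}(\sigma)}y_2^{\mathrm{ereccdrise}(\sigma)}u_1^{\mathrm{nrcpeak}(\sigma)}u_2^{\mathrm{nrcdfall}(\sigma)}v_1^{\mathrm{nrcval}(\sigma)}v_2^{\mathrm{nrcdrise}(\sigma)}\mathbf{w}^{\mathbf{fix}(\sigma)},$$ with $\mathbf{w}^{\mathbf{fix}(\sigma)}=\prod_{i\ \text{fixed point of}\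 \sigma}w_{\mathrm{psnest}(i,\sigma)}$.
   Context: $\mathfrak{S}_n$ is the set of permutations of $[n]$; $\mathbf{w}=(w_k)_{k\ge0}$ are indeterminates. For $\sigma\in\mathfrak{S}_n$ and $i\in[n]$: $i$ is a cycle peak if $\sigma^{ -1}(i)<i>\sigma(i)$, a cycle valley if $\sigma^{ -1}(i)>i<\sigma(i)$, a cycle double rise if $\sigma^{ -1}(i)<i<\sigma(i)$, a cycle double fall if $\sigma^{ -1}(i)>i>\sigma(i)$, a fixed point if $\sigma(i)=i$. An index $i$ is a record if $\sigma(j)<\sigma(i)$ for all $j<i$, an antirecord if $\sigma(j)>\sigma(i)$ for all $j>i$; exclusive record = record but not antirecord; exclusive antirecord = antirecord but not record; neither-record-antirecord = neither. eareccpeak (resp. eareccdfall) = number of cycle peaks (resp. cycle double falls) that are exclusive antirecords; ereccval (resp. ereccdrise) = number of cycle valleys (resp. cycle double rises) that are exclusive records; nrcpeak, nrcdfall, nrcval, nrcdrise = numbers of cycle peaks, cycle double falls, cycle valleys, cycle double rises that are neither-record-antirecords; minval = number of cycle valleys that are the smallest element of their cycle; nminval = number of the other cycle valleys. For a fixed point $i$, $\mathrm{psnest}(i,\sigma)=\#\{j<i:\sigma(j)>i\}$. -}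

module Defs where

open import Level using (Level)
open import Data.Nat using (ℕ; zero; suc; _<ᵇ_; _≡ᵇ_)
open import Data.Fin using (Fin; toℕ)
open import Data.Bool using (Bool; true; false; _∧_; _∨_; not)
open import Data.Vec using (Vec; []; _∷_; lookup)
open import Data.List using (List; []; _∷_; map; concatMap; filterᵇ; length; allFin; upTo)
open import Data.Bool.ListAction using (all; any)
open import Algebra.Bundles using (CommutativeSemiring)

-- Permutations of [n], represented as Fin n → Fin n (0-based; the
-- order on Fin n is that of toℕ, so this is order-isomorphic to [n]).

allVecs : (n m : ℕ) → List (Vec (Fin n) m)
allVecs n zero    = [] ∷ []
allVecs n (suc m) = concatMap (λ a → map (a ∷_) (allVecs n m)) (allFin n)

ltF : ∀ {n} → Fin n → Fin n → Bool
ltF a b = toℕ a <ᵇ toℕ b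

eqF : ∀ {n} → Fin n → Fin n → Bool
eqF a b = toℕ a ≡ᵇ toℕ b

allF : (n : ℕ) → (Fin n → Bool) → Bool
allF n p = all p (allFin n)

anyF : (n : ℕ) → (Fin n → Bool) → Bool
anyF n p = any p (allFin n)

countF : (n : ℕ) → (Fin n → Bool) → ℕ
countF n p = length (filterᵇ p (allFin n))

isInjective : ∀ {n} → Vec (Fin n) n → Bool
isInjective {n} v =
  allF n (λ i → allF n (λ j → not (eqF (lookup v i) (lookup v j)) ∨ eqF i j))

perms : (n : ℕ) → List (Fin n → Fin n)
perms n = map lookup (filterᵇ isInjective (allVecs n n))

-- Statistics of σ (meaningful for bijections σ)

module Stats {n : ℕ} (σ : Fin n → Fin n) where

  preBelow : Fin n → Bool
  preBelow i = anyF n (λ j → eqF (σ j) i ∧ ltF j i)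

  preAbove : Fin n → Bool
  preAbove i = anyF n (λ j → eqF (σ j) i ∧ ltF i j)

  cpeak cval cdrise cdfall fixpt : Fin n → Bool
  cpeak  i = preBelow i ∧ ltF (σ i) i
  cval   i = preAbove i ∧ ltF i (σ i)
  cdrise i = preBelow i ∧ ltF i (σ i)
  cdfall i = preAbove i ∧ ltF (σ i) i
  fixpt  i = eqF (σ i) i

  isRec isArec erec earec nra : Fin n → Bool
  isRec  i = allF n (λ j → not (ltF j i) ∨ ltF (σ j) (σ i))
  isArec i = allF n (λ j → not (ltF i j) ∨ ltF (σ i) (σ j))
  erec  i = isRec i ∧ not (isArec i)
  earec i = isArec i ∧ not (isRec i)
  nra   i = not (isRec i) ∧ not (isArec i)

  iter : ℕ → Fin n → Fin n
  iter zero    i = i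
  iter (suc k) i = σ (iter k i)

  cycMin : Fin n → Bool
  cycMin i = all (λ k → not (ltF (iter k i) i)) (upTo n)

  eareccpeak eareccdfall ereccval ereccdrise : ℕ
  nrcpeak nrcdfall nrcval nrcdrise minval nminval : ℕ
  eareccpeak  = countF n (λ i → cpeak i ∧ earec i)
  eareccdfall = countF n (λ i → cdfall i ∧ earec i)
  ereccval    = countF n (λ i → cval i ∧ erec i)
  ereccdrise  = countF n (λ i → cdrise i ∧ erec i)
  nrcpeak     = countF n (λ i → cpeak i ∧ nra i)
  nrcdfall    = countF n (λ i → cdfall i ∧ nra i)
  nrcval      = countF n (λ i → cval i ∧ nra i)
  nrcdrise    = countF n (λ i → cdrise i ∧ nra i)
  minval      = countF n (λ i → cval i ∧ cycMin i)
  nminval     = countF n (λ i → cval i ∧ not (cycMin i))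

  psnest : Fin n → ℕ
  psnest i = countF n (λ j → ltF j i ∧ ltF i (σ j))

  fixedPoints : List (Fin n)
  fixedPoints = filterᵇ fixpt (allFin n)

-- Generating polynomials, evaluated in an arbitrary commutative semiring
-- (identity for all commutative semirings and all values ⇔ identity of
-- polynomials with ℕ coefficients, taking R = the polynomial semiring).

module Poly {c ℓ : Level} (R : CommutativeSemiring c ℓ) where
  open CommutativeSemiring R

  pow : Carrier → ℕ → Carrier
  pow x zero    = 1#
  pow x (suc k) = x * pow x k

  sumL : List Carrier → Carrier
  sumL []       = 0#
  sumL (a ∷ as) = a + sumL as

  prodL : List Carrier → Carrier
  prodL []       = 1#
  prodL (a ∷ as) = a * prodL as

  wfix : ∀ {n} → (ℕ → Carrier) → (Fin n → Fin n) → Carrier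
  wfix w σ = prodL (map (λ i → w (psnest i)) fixedPoints)
    where open Stats σ

  Qtilde : (n : ℕ) (x₁ x₂ y₁ y₂ u₁ u₂ v₁ v₂ : Carrier) (w : ℕ → Carrier) → Carrier
  Qtilde n x₁ x₂ y₁ y₂ u₁ u₂ v₁ v₂ w = sumL (map term (perms n))
    where
      term : (Fin n → Fin n) → Carrier
      term σ = pow x₁ eareccpeak * pow x₂ eareccdfall * pow y₁ minval * pow y₂ ereccdrise
             * pow u₁ nrcpeak * pow u₂ nrcdfall * pow v₁ nminval * pow v₂ nrcdrise
             * wfix w σ
        where open Stats σ

  Q1 : (n : ℕ) (x₁ x₂ y₁ y₂ u₁ u₂ v₁ v₂ : Carrier) (w : ℕ → Carrier) → Carrier
  Q1 n x₁ x₂ y₁ y₂ u₁ u₂ v₁ v₂ w = sumL (map term (perms n))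
    where
      term : (Fin n → Fin n) → Carrier
      term σ = pow x₁ eareccpeak * pow x₂ eareccdfall * pow y₁ ereccval * pow y₂ ereccdrise
             * pow u₁ nrcpeak * pow u₂ nrcdfall * pow v₁ nrcval * pow v₂ nrcdrise
             * wfix w σ
        where open Stats σ

{-# OPTIONS --safe #-}
module Submission where

-- The non-excedance arcs of a permutation determine the type (peak, valley, double rise, double fall,
-- fixed point) of every index, the weights of all non-excedances, and the weights of the fixed points.
-- Given them, choose the values at the excedances from the largest position k down to the smallest.
-- The number of possible values at k is the number of j > k with σ(j) ≤ k, whatever was chosen before.
-- Exactly one of them, the largest, makes k a record; and if k is a cycle valley, exactly one of them
-- closes the path that currently ends at k into a cycle, i.e. makes k the minimum of its cycle.
-- So both polynomials sum the same product over the possible sets of non-excedance arcs, in which a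
-- valley with h possible values contributes y₁ + (h − 1) v₁ and a double rise y₂ + (h − 1) v₂.

open import Defs
open import Algebra.Bundles using (CommutativeMonoid; CommutativeSemiring)
open import Data.Nat as ℕ using (ℕ; zero; suc; _∸_; z≤n; s≤s; _<ᵇ_; _%_)
import Data.Nat.Properties as ℕₚ
open import Data.Nat.DivMod using (m≡m%n+[m/n]*n; m%n<n)
open import Data.Fin as Fin using (Fin; zero; suc; toℕ; fromℕ<; punchOut; _≤_; _<_)
open import Data.Fin.Properties as Finₚ
  using (toℕ-injective; toℕ-fromℕ<; toℕ<n; _≟_; any?; all?; <⇒notInjective; punchOut-injective; pigeonhole)
open import Data.Fin.Permutation using (permutation)
open import Data.Fin.Permutation.Components using (transpose; transpose-inverse)
open import Data.Bool as Bool using (Bool; true; false; T; T?; _∧_; _∨_; not; if_then_else_)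
open import Data.Bool.ListAction using (all; any)
open import Data.Bool.Properties using (∧-comm; ∧-identityʳ; if-eta)
open import Data.List using (List; []; _∷_; _++_; map; concatMap; filter; filterᵇ; length; tabulate; applyUpTo)
open import Data.List.Properties using (map-∘; filter-notAll)
open import Data.List.Membership.Propositional using (_∈_)
open import Data.List.Membership.Propositional.Properties using (∈-filter⁻)
open import Data.List.Relation.Unary.Any using (here)
open import Data.Vec as Vec using (Vec; []; _∷_; lookup)
open import Data.Vec.Properties using (lookup∘tabulate; tabulate∘lookup; tabulate-cong)
open import Data.Product using (∃; _×_; _,_; proj₁; proj₂)
open import Data.Sum using (_⊎_; inj₁; inj₂; [_,_]′)
open import Function using (_∘_; id)
open import Function.Definitions using (Injective)
open import Relation.Nullary using (¬_; Dec; yes; no; does; proof; contradiction)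
open import Relation.Nullary.Decidable using (_×-dec_; _⊎-dec_; ¬?)
open import Relation.Nullary.Reflects
  using (Reflects; ofʸ; ofⁿ; ¬-reflects; _×-reflects_; _→-reflects_; fromEquivalence)
open import Relation.Binary.Definitions using (tri<; tri≈; tri>)
open import Relation.Binary.PropositionalEquality
  using (_≡_; _≢_; _≗_; refl; sym; trans; cong; cong₂; subst; subst₂; module ≡-Reasoning)
import Algebra.Definitions.RawMonoid
import Algebra.Properties.CommutativeMonoid.Sum
import Algebra.Properties.Semiring.Sum
import Relation.Binary.Reasoning.Setoid

module ℕSum = Algebra.Properties.CommutativeMonoid.Sum ℕₚ.+-0-commutativeMonoid
open ℕSum using () renaming (sum to sumℕ)
open ℕₚ using () renaming (<ᵇ-reflects-< to <ᵇ-reflects)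

-- Records, cycle minima and crossing counts are defined for permutations, and a half-made choice is
-- not one. A state of the choice is therefore a whole permutation `τ` with a level `k`, read up to
-- `Agree k`. Level 0 leaves one permutation; level n leaves all permutations with the non-excedance
-- arcs of `τ`. The induction climbs the levels. Choosing the value a at k composes `τ` with the
-- transposition of a and `τ k`. The former holder of a, at a position at most k, receives `τ k` > k
-- and so stays an excedance: no choice leads to a dead end. The number of choices is the number of
-- arcs leading from positions at most k to values above k. A permutation has equally many arcs
-- crossing that cut downwards, and those are non-excedances, hence untouched by all choices. The
-- descending order serves both statistics. Whether k is a record depends on the set of values left
-- for the positions up to k, and a path along decided arcs that ends at k never goes below k.

Inj : ∀ {n} → (Fin n → Fin n) → Set
Inj = Injective _≡_ _≡_

-- Boolean statistics and the propositions they decide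

reflects-≡ : ∀ {p q} {P : Set p} {Q : Set q} {a b} →
  Reflects P a → Reflects Q b → (P → Q) → (Q → P) → a ≡ b
reflects-≡ (ofʸ p)  (ofʸ q)  f g = refl
reflects-≡ (ofʸ p)  (ofⁿ ¬q) f g = contradiction (f p) ¬q
reflects-≡ (ofⁿ ¬p) (ofʸ q)  f g = contradiction (g q) ¬p
reflects-≡ (ofⁿ ¬p) (ofⁿ ¬q) f g = refl

reflects-map : ∀ {p q} {P : Set p} {Q : Set q} {a} →
  (P → Q) → (Q → P) → Reflects P a → Reflects Q a
reflects-map f g (ofʸ p)  = ofʸ (f p)
reflects-map f g (ofⁿ ¬p) = ofⁿ (¬p ∘ g)

reflects-true : ∀ {p} {P : Set p} {b} → Reflects P b → P → b ≡ true
reflects-true (ofʸ _)  p = refl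
reflects-true (ofⁿ ¬p) p = contradiction p ¬p

reflects-false : ∀ {p} {P : Set p} {b} → Reflects P b → ¬ P → b ≡ false
reflects-false (ofʸ p) ¬p = contradiction p ¬p
reflects-false (ofⁿ _) ¬p = refl

reflects-sound : ∀ {p} {P : Set p} {b} → Reflects P b → b ≡ true → P
reflects-sound (ofʸ p) refl = p

all-tabulate-reflects : ∀ {m} {A : Set} {P : A → Set} {p : A → Bool} (f : Fin m → A) →
  (∀ a → Reflects (P a) (p a)) → Reflects (∀ i → P (f i)) (all p (tabulate f))
all-tabulate-reflects {zero}  f r = ofʸ λ ()
all-tabulate-reflects {suc m} f r =
  reflects-map (λ { (h , t) zero → h ; (h , t) (suc i) → t i }) (λ h → h zero , h ∘ suc)
    (r (f zero) ×-reflects all-tabulate-reflects (f ∘ suc) r)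

all-applyUpTo-reflects : ∀ {A : Set} {P : A → Set} {p : A → Bool} (f : ℕ → A) m →
  (∀ a → Reflects (P a) (p a)) → Reflects (∀ t → t ℕ.< m → P (f t)) (all p (applyUpTo f m))
all-applyUpTo-reflects f zero    r = ofʸ λ _ ()
all-applyUpTo-reflects f (suc m) r =
  reflects-map (λ { (h , t) zero _ → h ; (h , t) (suc i) (s≤s lt) → t i lt })
    (λ h → h 0 (s≤s z≤n) , λ t lt → h (suc t) (s≤s lt))
    (r (f 0) ×-reflects all-applyUpTo-reflects (f ∘ suc) m r)

any-tabulate-reflects : ∀ {m} {A : Set} {P : A → Set} {p : A → Bool} (f : Fin m → A) →
  (∀ a → Reflects (P a) (p a)) → Reflects (∃ λ i → P (f i)) (any p (tabulate f))
any-tabulate-reflects {zero}  f r = ofⁿ λ ()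
any-tabulate-reflects {suc m} {P = P} f r = go (r (f zero)) (any-tabulate-reflects (f ∘ suc) r)
  where
  go : ∀ {a b} → Reflects (P (f zero)) a → Reflects (∃ λ i → P (f (suc i))) b →
       Reflects (∃ λ i → P (f i)) (a ∨ b)
  go (ofʸ p)  _             = ofʸ (zero , p)
  go (ofⁿ ¬p) (ofʸ (i , p)) = ofʸ (suc i , p)
  go (ofⁿ ¬p) (ofⁿ ¬q)      = ofⁿ λ { (zero , p) → ¬p p ; (suc i , p) → ¬q (i , p) }

ltF-reflects : ∀ {n} (i j : Fin n) → Reflects (i < j) (ltF i j)
ltF-reflects i j = <ᵇ-reflects (toℕ i) (toℕ j)

eqF-reflects : ∀ {n} (i j : Fin n) → Reflects (i ≡ j) (eqF i j)
eqF-reflects i j = fromEquivalence (toℕ-injective ∘ ℕₚ.≡ᵇ⇒≡ (toℕ i) (toℕ j)) (ℕₚ.≡⇒≡ᵇ (toℕ i) (toℕ j) ∘ cong toℕ)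

module _ {n} (σ : Fin n → Fin n) where
  open Stats σ

  preBelow-reflects : ∀ i → Reflects (∃ λ j → σ j ≡ i × j < i) (preBelow i)
  preBelow-reflects i = any-tabulate-reflects id λ j → eqF-reflects (σ j) i ×-reflects ltF-reflects j i

  preAbove-reflects : ∀ i → Reflects (∃ λ j → σ j ≡ i × i < j) (preAbove i)
  preAbove-reflects i = any-tabulate-reflects id λ j → eqF-reflects (σ j) i ×-reflects ltF-reflects i j

  isRec-reflects : ∀ i → Reflects (∀ j → j < i → σ j < σ i) (isRec i)
  isRec-reflects i = all-tabulate-reflects id λ j → ltF-reflects j i →-reflects ltF-reflects (σ j) (σ i)

  isArec-reflects : ∀ i → Reflects (∀ j → i < j → σ i < σ j) (isArec i)
  isArec-reflects i = all-tabulate-reflects id λ j → ltF-reflects i j →-reflects ltF-reflects (σ i) (σ j)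

  cycMin-reflects : ∀ i → Reflects (∀ t → t ℕ.< n → ¬ iter t i < i) (cycMin i)
  cycMin-reflects i = all-applyUpTo-reflects {P = λ t → ¬ iter t i < i} id n
    λ t → ¬-reflects (ltF-reflects (iter t i) i)

-- Counting and finite bijections

-- A sum rather than the length of a filtered list, so that reindexing by a permutation and termwise
-- splitting of sums apply to counts.
# : ∀ {n} → (Fin n → Bool) → ℕ
# p = sumℕ λ i → if p i then 1 else 0

#-cong : ∀ {n} {p q : Fin n → Bool} → p ≗ q → # p ≡ # q
#-cong eq = ℕSum.sum-cong-≗ λ i → cong (if_then 1 else 0) (eq i)

#≡0⇒false : ∀ {n} (p : Fin n → Bool) → # p ≡ 0 → ∀ i → p i ≡ false
#≡0⇒false {suc n} p eq i with p zero in e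
#≡0⇒false {suc n} p eq zero    | false = e
#≡0⇒false {suc n} p eq (suc i) | false = #≡0⇒false (p ∘ suc) eq i

#-none : ∀ {n} {p : Fin n → Bool} → (∀ i → p i ≡ false) → # p ≡ 0
#-none {n} h = trans (#-cong h) (ℕSum.sum-replicate-zero n)

#-split : ∀ {n} (p q : Fin n → Bool) → # p ≡ # (λ i → p i ∧ q i) ℕ.+ # (λ i → p i ∧ not (q i))
#-split p q = trans (ℕSum.sum-cong-≗ λ i → lem (p i) (q i)) (ℕSum.∑-distrib-+ (λ i → if p i ∧ q i then 1 else 0) _)
  where
  lem : ∀ a b → (if a then 1 else 0) ≡ (if a ∧ b then 1 else 0) ℕ.+ (if a ∧ not b then 1 else 0)
  lem false _     = refl
  lem true  false = refl
  lem true  true  = refl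

#-difference : ∀ {n} (p q : Fin n → Bool) → # p ≡ # q →
  # (λ i → p i ∧ not (q i)) ≡ # (λ i → not (p i) ∧ q i)
#-difference p q eq = ℕₚ.+-cancelˡ-≡ (# λ i → p i ∧ q i) _ _ (begin
  # (λ i → p i ∧ q i) ℕ.+ # (λ i → p i ∧ not (q i))  ≡⟨ #-split p q ⟨
  # p                                                ≡⟨ eq ⟩
  # q                                                ≡⟨ #-split q p ⟩
  # (λ i → q i ∧ p i) ℕ.+ # (λ i → q i ∧ not (p i))  ≡⟨ cong₂ ℕ._+_ (#-cong λ i → ∧-comm (q i) (p i))
                                                                (#-cong λ i → ∧-comm (q i) (not (p i))) ⟩
  # (λ i → p i ∧ q i) ℕ.+ # (λ i → not (p i) ∧ q i)  ∎)
  where open ≡-Reasoning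

#-transfer : ∀ {n} {P Q : Fin n → Set} {p q : Fin n → Bool} →
  (∀ i → Reflects (P i) (p i)) → (∀ i → Reflects (Q i) (q i)) → # p ≡ # q → ∃ P → ∃ Q
#-transfer {P = P} {Q} {p} {q} rp rq eq (i , pi) with any? (λ j → q j Bool.≟ true)
... | yes (j , qj) = j , reflects-sound (rq j) qj
... | no ¬q = contradiction (trans (sym (reflects-true (rp i) pi)) (#≡0⇒false p (trans eq (#-none none)) i)) λ ()
  where
  none : ∀ j → q j ≡ false
  none j with q j in e
  ... | true  = contradiction (j , e) ¬q
  ... | false = refl

greatest : ∀ {n} {P : Fin n → Set} → (∀ i → Dec (P i)) → ∃ P → ∃ λ i → P i × ∀ j → P j → j ≤ i
greatest {suc n} P? (i , pi) with any? (P? ∘ suc)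
... | yes ∃P with greatest (P? ∘ suc) ∃P
...   | m , pm , max = suc m , pm , λ { zero _ → z≤n ; (suc j) pj → s≤s (max j pj) }
greatest {suc n} P? (zero  , pi) | no ¬∃ = zero , pi , λ { zero _ → z≤n ; (suc j) pj → contradiction (j , pj) ¬∃ }
greatest {suc n} P? (suc i , pi) | no ¬∃ = contradiction (i , pi) ¬∃

-- If `b` were missed, punching it out of the codomain would inject a finite set into one with one
-- element fewer.
injective⇒surjective : ∀ {n} (σ : Fin n → Fin n) → Inj σ → ∀ b → ∃ λ j → σ j ≡ b
injective⇒surjective {suc n} σ inj b with any? (λ j → σ j ≟ b)
... | yes p = p
... | no ¬p = contradiction (λ {x} {y} e → inj (punchOut-injective (ne x) (ne y) e))
    (<⇒notInjective {f = λ j → punchOut (ne j)} (ℕₚ.n<1+n n))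
  where
  ne : ∀ j → b ≢ σ j
  ne j e = ¬p (j , sym e)

-- Arcs crossing a cut

-- The cut lies just below `t`. It is a natural number because both the cut below a position i (`t`
-- = i) and the cut above it (`t` = i + 1) occur.
up down : ∀ {n} → ℕ → (Fin n → Fin n) → ℕ
up   t σ = # λ j → (toℕ j <ᵇ t) ∧ not (toℕ (σ j) <ᵇ t)
down t σ = # λ j → not (toℕ j <ᵇ t) ∧ (toℕ (σ j) <ᵇ t)

module _ {n} (σ : Fin n → Fin n) where

  up-reflects : ∀ t j → Reflects (toℕ j ℕ.< t × ¬ toℕ (σ j) ℕ.< t) ((toℕ j <ᵇ t) ∧ not (toℕ (σ j) <ᵇ t))
  up-reflects t j = <ᵇ-reflects _ _ ×-reflects ¬-reflects (<ᵇ-reflects _ _)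

  down-reflects : ∀ t j → Reflects (¬ toℕ j ℕ.< t × toℕ (σ j) ℕ.< t) (not (toℕ j <ᵇ t) ∧ (toℕ (σ j) <ᵇ t))
  down-reflects t j = ¬-reflects (<ᵇ-reflects _ _) ×-reflects <ᵇ-reflects _ _

module Bijection {n} (σ : Fin n → Fin n) (inj : Inj σ) where

  inv : Fin n → Fin n
  inv b = proj₁ (injective⇒surjective σ inj b)

  σ-inv : ∀ b → σ (inv b) ≡ b
  σ-inv b = proj₂ (injective⇒surjective σ inj b)

  inv-σ : ∀ i → inv (σ i) ≡ i
  inv-σ i = inj (σ-inv (σ i))

  #-permute : ∀ p → # p ≡ # (p ∘ σ)
  #-permute p = ℕSum.sum-permute _ (permutation σ inv σ-inv inv-σ)

  -- As many values as positions lie below `t`; the arcs with both ends below `t` are common to the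
  -- two counts and cancel.
  up≡down : ∀ t → up t σ ≡ down t σ
  up≡down t = #-difference (λ j → toℕ j <ᵇ t) (λ j → toℕ (σ j) <ᵇ t) (#-permute λ j → toℕ j <ᵇ t)

  -- The arc out of `i` crosses the cut above `i` upwards, so some arc crosses it downwards: a later
  -- position has a value at most `i`. Hence on excedances an exclusive record is just a record, and
  -- a neither-record-antirecord just a non-record.
  excedance-not-antirecord : ∀ i → i < σ i → ¬ (∀ j → i < j → σ i < σ j)
  excedance-not-antirecord i i<σi arec
    with #-transfer (up-reflects σ (suc (toℕ i))) (down-reflects σ (suc (toℕ i))) (up≡down (suc (toℕ i)))
           (i , ℕₚ.n<1+n _ , λ lt → ℕₚ.<⇒≱ i<σi (ℕ.s≤s⁻¹ lt))
  ... | j , j≰i , σj≤i = ℕₚ.<-asym (arec j (ℕₚ.≰⇒> (j≰i ∘ s≤s))) (ℕₚ.≤-<-trans (ℕ.s≤s⁻¹ σj≤i) i<σi)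

  -- Dually, the arc out of `i` crosses the cut below `i` downwards, so some earlier position has a
  -- value at least `i`.
  descent-not-record : ∀ i → σ i < i → ¬ (∀ j → j < i → σ j < σ i)
  descent-not-record i σi<i rec
    with #-transfer (down-reflects σ (toℕ i)) (up-reflects σ (toℕ i)) (sym (up≡down (toℕ i)))
           (i , ℕₚ.<-irrefl refl , σi<i)
  ... | j , j<i , σj≮i = σj≮i (ℕₚ.<-trans (rec j j<i) σi<i)

  -- The preimage of `i` is unique and differs from `i`. So one Boolean, `preAbove`, separates
  -- valleys from double rises among the excedances.
  preBelow≡¬preAbove : ∀ i → i < σ i → Stats.preBelow σ i ≡ not (Stats.preAbove σ i)
  preBelow≡¬preAbove i i<σi = reflects-≡ (preBelow-reflects σ i) (¬-reflects (preAbove-reflects σ i))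
    (λ { (j , e , j<i) (j′ , e′ , i<j′) → ℕₚ.<-asym j<i (subst (i <_) (inj (trans e′ (sym e))) i<j′) })
    λ ¬above → inv i , σ-inv i , below ¬above
    where
    below : ¬ (∃ λ j → σ j ≡ i × i < j) → inv i < i
    below ¬above with Finₚ.<-cmp (inv i) i
    ... | tri< lt _ _ = lt
    ... | tri≈ _ e _  = contradiction i<σi (ℕₚ.<-irrefl (cong toℕ (trans (sym (σ-inv i)) (cong σ e))))
    ... | tri> _ _ gt = contradiction (inv i , σ-inv i , gt) ¬above

length-filterᵇ-tabulate : ∀ {m} {A : Set} (p : A → Bool) (f : Fin m → A) →
  length (filterᵇ p (tabulate f)) ≡ # (p ∘ f)
length-filterᵇ-tabulate {zero}  p f = refl
length-filterᵇ-tabulate {suc m} p f with p (f zero)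
... | true  = cong suc (length-filterᵇ-tabulate p (f ∘ suc))
... | false = length-filterᵇ-tabulate p (f ∘ suc)

-- Permutations with the same non-excedance arcs

-- The right alternative is an undecided arc: it leaves a position below `k` and is known only to be
-- an excedance on both sides.
AgreeAt : ∀ {n} → ℕ → (j x y : Fin n) → Set
AgreeAt k j x y = x ≡ y ⊎ (toℕ j ℕ.< k × j < x × j < y)

-- σ and τ have the same non-excedance arcs, and the same arcs out of every position ≥ k.
Agree : ∀ {n} → ℕ → (σ τ : Fin n → Fin n) → Set
Agree k σ τ = ∀ j → AgreeAt k j (σ j) (τ j)

agree? : ∀ {n} k (σ τ : Fin n → Fin n) → Dec (Agree k σ τ)
agree? k σ τ = all? λ j → (σ j ≟ τ j) ⊎-dec ((toℕ j ℕₚ.<? k) ×-dec ((j Fin.<? σ j) ×-dec (j Fin.<? τ j)))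

module _ {n : ℕ} where

  agree-refl : ∀ {k} (σ : Fin n → Fin n) → Agree k σ σ
  agree-refl σ j = inj₁ refl

  agree-sym : ∀ {k} {σ τ : Fin n → Fin n} → Agree k σ τ → Agree k τ σ
  agree-sym A j with A j
  ... | inj₁ e           = inj₁ (sym e)
  ... | inj₂ (a , b , c) = inj₂ (a , c , b)

  agree-trans : ∀ {k} {σ τ ρ : Fin n → Fin n} → Agree k σ τ → Agree k τ ρ → Agree k σ ρ
  agree-trans A B j with A j | B j
  ... | inj₁ e           | inj₁ e′          = inj₁ (trans e e′)
  ... | inj₁ e           | inj₂ (a , b , c) = inj₂ (a , subst (j <_) (sym e) b , c)
  ... | inj₂ (a , b , c) | inj₁ e           = inj₂ (a , b , subst (j <_) e c)
  ... | inj₂ (a , b , _) | inj₂ (_ , _ , c) = inj₂ (a , b , c)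

  agree-mono : ∀ {k l} {σ τ : Fin n → Fin n} → k ℕ.≤ l → Agree k σ τ → Agree l σ τ
  agree-mono k≤l A j with A j
  ... | inj₁ e       = inj₁ e
  ... | inj₂ (a , r) = inj₂ (ℕₚ.<-≤-trans a k≤l , r)

  agree-above : ∀ {k} {σ τ : Fin n → Fin n} → Agree k σ τ → ∀ {j} → k ℕ.≤ toℕ j → σ j ≡ τ j
  agree-above A {j} k≤j with A j
  ... | inj₁ e       = e
  ... | inj₂ (a , _) = contradiction k≤j (ℕₚ.<⇒≱ a)

  agree-nonexcedance : ∀ {k} {σ τ : Fin n → Fin n} → Agree k σ τ → ∀ {j} → σ j ≤ j → σ j ≡ τ j
  agree-nonexcedance A {j} le with A j
  ... | inj₁ e           = e
  ... | inj₂ (_ , b , _) = contradiction le (ℕₚ.<⇒≱ b)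

  agree-excedance : ∀ {k} {σ τ : Fin n → Fin n} → Agree k σ τ → ∀ {j} → j < σ j → j < τ j
  agree-excedance A {j} lt with A j
  ... | inj₁ e           = subst (j <_) e lt
  ... | inj₂ (_ , _ , c) = c

  -- An arc reaching `i` from below is an excedance, so its source may change. Look at the preimage
  -- of `i` under `τ` instead: either its arc is shared, and injectivity of `σ` makes it the old
  -- source, or it is an excedance and thus starts below `i`.
  preBelow-≡ : ∀ {k} {σ τ : Fin n → Fin n} → Inj σ → Inj τ → Agree k σ τ →
    ∀ i → Stats.preBelow σ i ≡ Stats.preBelow τ i
  preBelow-≡ {σ = σ} {τ} injσ injτ A i = reflects-≡ (preBelow-reflects σ i) (preBelow-reflects τ i)
    (mono injσ injτ A) (mono injτ injσ (agree-sym A))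
    where
    mono : ∀ {k} {σ τ : Fin n → Fin n} → Inj σ → Inj τ → Agree k σ τ →
      (∃ λ j → σ j ≡ i × j < i) → ∃ λ j → τ j ≡ i × j < i
    mono {τ = τ} injσ injτ A (j , e , j<i) with injective⇒surjective τ injτ i
    ... | j′ , e′ with A j′
    ...   | inj₁ eq          = j′ , e′ , subst (_< i) (injσ (trans e (trans (sym e′) (sym eq)))) j<i
    ...   | inj₂ (_ , _ , c) = j′ , e′ , subst (j′ <_) e′ c

  preAbove-≡ : ∀ {k} {σ τ : Fin n → Fin n} → Agree k σ τ → ∀ i → Stats.preAbove σ i ≡ Stats.preAbove τ i
  preAbove-≡ {σ = σ} {τ} A i = reflects-≡ (preAbove-reflects σ i) (preAbove-reflects τ i) (mono A) (mono (agree-sym A))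
    where
    mono : ∀ {k} {σ τ : Fin n → Fin n} → Agree k σ τ →
      (∃ λ j → σ j ≡ i × i < j) → ∃ λ j → τ j ≡ i × i < j
    mono A (j , refl , i<j) = j , sym (agree-nonexcedance A (ℕₚ.<⇒≤ i<j)) , i<j

  -- A shared arc out of j > `i` keeps its value, and an undecided one has a value above j, hence
  -- above the value at `i`, whatever is chosen.
  isArec-≡ : ∀ {k} {σ τ : Fin n → Fin n} → Agree k σ τ →
    ∀ i → σ i ≤ i → Stats.isArec σ i ≡ Stats.isArec τ i
  isArec-≡ {σ = σ} {τ} A i le = reflects-≡ (isArec-reflects σ i) (isArec-reflects τ i)
    (mono A le) (mono (agree-sym A) (subst (_≤ i) (agree-nonexcedance A le) le))
    where
    mono : ∀ {k} {σ τ : Fin n → Fin n} → Agree k σ τ → σ i ≤ i →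
      (∀ j → i < j → σ i < σ j) → ∀ j → i < j → τ i < τ j
    mono A le arec j i<j with agree-nonexcedance A le | A j
    ... | ei | inj₁ e           = subst₂ _<_ ei e (arec j i<j)
    ... | ei | inj₂ (_ , _ , c) = ℕₚ.≤-<-trans (subst (_≤ i) ei le) (ℕₚ.<-trans i<j c)

  -- Every arc crossing a cut downwards is a non-excedance and therefore shared.
  down-≡ : ∀ {k} {σ τ : Fin n → Fin n} → Agree k σ τ → ∀ t → down t σ ≡ down t τ
  down-≡ {σ = σ} {τ} A t = #-cong {n} λ j →
    reflects-≡ (down-reflects σ t j) (down-reflects τ t j) (mono A) (mono (agree-sym A))
    where
    mono : ∀ {k} {σ τ : Fin n → Fin n} → Agree k σ τ → ∀ {j} →
      ¬ toℕ j ℕ.< t × toℕ (σ j) ℕ.< t → ¬ toℕ j ℕ.< t × toℕ (τ j) ℕ.< t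
    mono A (j≮t , σj<t) = j≮t , subst (λ v → toℕ v ℕ.< t)
      (agree-nonexcedance A (ℕₚ.<⇒≤ (ℕₚ.<-≤-trans σj<t (ℕₚ.≮⇒≥ j≮t)))) σj<t

  -- The nestings over `i` are the arcs crossing the cut below `i` upwards: such an arc cannot end
  -- at `i`, which is its own value. Balancing turns them into downward arcs, so the weight of a
  -- fixed point depends on non-excedance arcs alone.
  psnest≡down : ∀ (σ : Fin n → Fin n) → Inj σ → ∀ i → σ i ≡ i → Stats.psnest σ i ≡ down (toℕ i) σ
  psnest≡down σ inj i fix = begin
    Stats.psnest σ i                    ≡⟨ length-filterᵇ-tabulate (λ j → ltF j i ∧ ltF i (σ j)) id ⟩
    # (λ j → ltF j i ∧ ltF i (σ j))     ≡⟨ #-cong {n} (λ j → reflects-≡ (ltF-reflects j i ×-reflects ltF-reflects i (σ j))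
                                                  (up-reflects σ (toℕ i) j) to from) ⟩
    up (toℕ i) σ                        ≡⟨ Bijection.up≡down σ inj (toℕ i) ⟩
    down (toℕ i) σ                      ∎
    where
    open ≡-Reasoning
    to : ∀ {j} → j < i × i < σ j → j < i × ¬ σ j < i
    to (a , b) = a , ℕₚ.<-asym b
    from : ∀ {j} → j < i × ¬ σ j < i → j < i × i < σ j
    from {j} (a , b) = a , ℕₚ.≤∧≢⇒< (ℕₚ.≮⇒≥ b)
      λ e → ℕₚ.<-irrefl (cong toℕ (inj (trans (sym (toℕ-injective e)) (sym fix)))) a

-- Among the possible values at the excedance k, once the arcs out of positions > k and the
-- non-excedance arcs are fixed, exactly one satisfies sp.
UniqueChoice : (∀ {n} → (Fin n → Fin n) → Fin n → Bool) → Set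
UniqueChoice sp = ∀ {n} (τ : Fin n → Fin n) → Inj τ → ∀ k → k < τ k →
  ∃ λ a → k < a × (∃ λ u → u ≤ k × τ u ≡ a) ×
    (∀ σ → Inj σ → Agree (suc (toℕ k)) σ τ → Reflects (σ k ≡ a) (sp σ k))

-- The value that makes an excedance a record

-- `σ` and `τ` coincide after `k`, so being bijections they use the same set of values on the
-- positions up to `k`.
agree-low-values : ∀ {n} {σ τ : Fin n → Fin n} → Inj σ → Inj τ → ∀ {k : Fin n} → Agree (suc (toℕ k)) σ τ →
  ∀ {j} → j ≤ k → ∃ λ u → u ≤ k × τ u ≡ σ j
agree-low-values {σ = σ} {τ} injσ injτ {k} A {j} j≤k with injective⇒surjective τ injτ (σ j)
... | u , e with u Fin.≤? k
...   | yes u≤k = u , u≤k , e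
...   | no u≰k  = contradiction (subst (_≤ k) (sym (injσ (trans (agree-above A (ℕₚ.≰⇒> u≰k)) e))) j≤k) u≰k

record⇔greatest : ∀ {n} (σ : Fin n → Fin n) → Inj σ → ∀ {k a} →
  (∃ λ u → u ≤ k × σ u ≡ a) → (∀ {j} → j ≤ k → σ j ≤ a) → Reflects (σ k ≡ a) (Stats.isRec σ k)
record⇔greatest σ inj {k} {a} (u , u≤k , σu≡a) σ≤a = reflects-map onlyif if (isRec-reflects σ k)
  where
  onlyif : (∀ j → j < k → σ j < σ k) → σ k ≡ a
  onlyif rec with Finₚ.<-cmp u k
  ... | tri< lt _ _   = contradiction (σ≤a ℕₚ.≤-refl) (ℕₚ.<⇒≱ (subst (_< σ k) σu≡a (rec u lt)))
  ... | tri≈ _ refl _ = σu≡a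
  ... | tri> _ _ gt   = contradiction u≤k (ℕₚ.<⇒≱ gt)

  if : σ k ≡ a → ∀ j → j < k → σ j < σ k
  if e j j<k = ℕₚ.≤∧≢⇒< (subst (σ j ≤_) (sym e) (σ≤a (ℕₚ.<⇒≤ j<k)))
    λ eq → ℕₚ.<-irrefl (cong toℕ (inj (toℕ-injective eq))) j<k

-- The greatest value on the positions up to `k` depends only on the set of those values, which all
-- members of the class share. It exceeds `k` because `τ k` is among them.
record-uniqueChoice : UniqueChoice Stats.isRec
record-uniqueChoice τ injτ k k<τk
  with greatest (λ a → any? λ u → (u Fin.≤? k) ×-dec (τ u ≟ a)) (τ k , k , ℕₚ.≤-refl , refl)
... | a , (u , u≤k , refl) , max =
  a , ℕₚ.<-≤-trans k<τk (max _ (k , ℕₚ.≤-refl , refl)) , (u , u≤k , refl) , λ σ injσ A →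
    record⇔greatest σ injσ (agree-low-values injτ injσ (agree-sym A) u≤k)
      (λ j≤k → max _ (agree-low-values injσ injτ A j≤k))

-- Orbits, and the value that makes a valley a cycle minimum

iter-shift : ∀ {n} (σ : Fin n → Fin n) t i → Stats.iter σ t (σ i) ≡ σ (Stats.iter σ t i)
iter-shift σ zero    i = refl
iter-shift σ (suc t) i = cong σ (iter-shift σ t i)

module Orbit {n} (σ : Fin n → Fin n) (inj : Inj σ) where
  open Stats σ using (iter)

  iter-+ : ∀ a b i → iter (a ℕ.+ b) i ≡ iter a (iter b i)
  iter-+ zero    b i = refl
  iter-+ (suc a) b i = cong σ (iter-+ a b i)

  iter-injective : ∀ a {i j} → iter a i ≡ iter a j → i ≡ j
  iter-injective zero    e = e
  iter-injective (suc a) e = iter-injective a (inj e)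

  -- Two of the n + 1 iterates with exponents 0 to n coincide, and injectivity cancels the smaller
  -- exponent.
  period : ∀ i → ∃ λ p → suc p ℕ.≤ n × iter (suc p) i ≡ i
  period i with pigeonhole (ℕₚ.n<1+n n) (λ t → iter (toℕ t) i)
  ... | a , b , a<b , e = toℕ b ∸ suc (toℕ a) , le , sym (iter-injective (toℕ a) (begin
      iter (toℕ a) i                                       ≡⟨ e ⟩
      iter (toℕ b) i                                       ≡⟨ cong (λ t → iter t i) split ⟨
      iter (toℕ a ℕ.+ suc (toℕ b ∸ suc (toℕ a))) i         ≡⟨ iter-+ (toℕ a) _ i ⟩
      iter (toℕ a) (iter (suc (toℕ b ∸ suc (toℕ a))) i)    ∎))
    where
    open ≡-Reasoning
    split : toℕ a ℕ.+ suc (toℕ b ∸ suc (toℕ a)) ≡ toℕ b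
    split = trans (ℕₚ.+-suc (toℕ a) _) (ℕₚ.m+[n∸m]≡n a<b)
    le : suc (toℕ b ∸ suc (toℕ a)) ℕ.≤ n
    le = ℕₚ.≤-trans (subst (suc (toℕ b ∸ suc (toℕ a)) ℕ.≤_) split (ℕₚ.m≤n+m _ (toℕ a))) (ℕ.s≤s⁻¹ (Finₚ.toℕ<n b))

  iter-multiple : ∀ {p i} → iter p i ≡ i → ∀ q → iter (q ℕ.* p) i ≡ i
  iter-multiple {p} {i} e zero    = refl
  iter-multiple {p} {i} e (suc q) = trans (iter-+ p (q ℕ.* p) i) (trans (cong (iter p) (iter-multiple e q)) e)

  -- `cycMin` tests only exponents below n; taking remainders modulo a period at most n shows that
  -- these exhaust the orbit.
  iter-reduce : ∀ i t → ∃ λ r → r ℕ.< n × iter t i ≡ iter r i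
  iter-reduce i t with period i
  ... | p , p<n , e = t % suc p , ℕₚ.<-≤-trans (m%n<n t (suc p)) p<n , (begin
      iter t i                                          ≡⟨ cong (λ s → iter s i) (m≡m%n+[m/n]*n t (suc p)) ⟩
      iter (t % suc p ℕ.+ (t ℕ./ suc p) ℕ.* suc p) i    ≡⟨ iter-+ (t % suc p) _ i ⟩
      iter (t % suc p) (iter ((t ℕ./ suc p) ℕ.* suc p) i)  ≡⟨ cong (iter (t % suc p)) (iter-multiple e (t ℕ./ suc p)) ⟩
      iter (t % suc p) i                                ∎)
    where open ≡-Reasoning

  -- With `suc p` a period of `x`, the m steps already made and m·p further ones amount to m full
  -- turns.
  iter-back : ∀ m {x k} → iter m x ≡ k → ∃ λ t → iter t k ≡ x
  iter-back m {x} refl with period x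
  ... | p , _ , e = m ℕ.* p , (begin
      iter (m ℕ.* p) (iter m x)  ≡⟨ iter-+ (m ℕ.* p) m x ⟨
      iter (m ℕ.* p ℕ.+ m) x     ≡⟨ cong (λ s → iter s x) (trans (ℕₚ.+-comm _ m) (sym (ℕₚ.*-suc m p))) ⟩
      iter (m ℕ.* suc p) x       ≡⟨ iter-multiple e m ⟩
      x                          ∎)
    where open ≡-Reasoning

-- Only the arcs out of open positions may differ between τ and a σ with Agree (suc k) σ τ.
Open : ∀ {n} → (Fin n → Fin n) → Fin n → Fin n → Set
Open τ k x = x ≤ k × x < τ x

-- A forward path from the index to `k`. Every arc on it is shared by the whole class, so a path of
-- one member is a path of all.
data Path {n} (τ : Fin n → Fin n) (k : Fin n) : Fin n → Set where
  here : Path τ k k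
  step : ∀ {x} → ¬ Open τ k x → Path τ k (τ x) → Path τ k x

module _ {n} {τ : Fin n → Fin n} {k : Fin n} where

  -- The walk from `z` to `k` is cut after its last open arc; what remains is a path starting at the
  -- value of that arc.
  path-start : ∀ m z → Stats.iter τ m z ≡ k → Path τ k z ⊎ ∃ λ u → Open τ k u × Path τ k (τ u)
  path-start zero    z refl = inj₁ here
  path-start (suc m) z e with path-start m (τ z) (trans (iter-shift τ m z) e)
  ... | inj₂ found = inj₂ found
  ... | inj₁ path with (z Fin.≤? k) ×-dec (z Fin.<? τ z)
  ...   | yes open′ = inj₂ (z , open′ , path)
  ...   | no closed = inj₁ (step closed path)

  -- Below `k` an arc that is not open is a non-excedance, so a path that were once below `k` would
  -- stay there and never reach `k`.
  path-≥ : ∀ {x} → Path τ k x → ¬ x < k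
  path-≥ here              x<k = ℕₚ.<-irrefl refl x<k
  path-≥ (step closed path) x<k = path-≥ path
    (ℕₚ.≤-<-trans (ℕₚ.≮⇒≥ λ x<τx → closed (ℕₚ.<⇒≤ x<k , x<τx)) x<k)

  path-length : ∀ {x} → Path τ k x → ∃ λ m → Stats.iter τ m x ≡ k
  path-length here = 0 , refl
  path-length {x} (step _ path) with path-length path
  ... | m , e = suc m , trans (sym (iter-shift τ m x)) e

  path-closed : Path τ k (τ k) → ∀ t → Path τ k (Stats.iter τ t k)
  path-closed loop zero    = here
  path-closed loop (suc t) with path-closed loop t
  ... | p = next p
    where
    next : ∀ {x} → Path τ k x → Path τ k (τ x)
    next here         = loop
    next (step _ path) = path

path-agree : ∀ {n} {σ τ : Fin n → Fin n} {k} → Agree (suc (toℕ k)) σ τ → ∀ {x} → Path τ k x → Path σ k x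
path-agree A here = here
path-agree {σ = σ} {τ} {k} A {x} (step closed path) with A x
... | inj₂ (x≤k , _ , x<τx) = contradiction (ℕ.s≤s⁻¹ x≤k , x<τx) closed
... | inj₁ e = step (λ { (x≤k , x<σx) → closed (x≤k , subst (x <_) e x<σx) })
                    (subst (Path σ k) (sym e) (path-agree A path))

-- Both polynomials read double rises through records; they differ only at valleys, which `preAbove`
-- singles out among the excedances.
cycMinOrRecord : ∀ {n} → (Fin n → Fin n) → Fin n → Bool
cycMinOrRecord σ i = if Stats.preAbove σ i then Stats.cycMin σ i else Stats.isRec σ i

-- The path puts u on the cycle of k, so if k is the minimum of that cycle then u ≤ k forces u = k;
-- conversely, the cycle closed by k → σ u consists of the path, which stays ≥ k.
cycMin⇔closing : ∀ {n} (σ : Fin n → Fin n) → Inj σ → ∀ {k u} → u ≤ k → Path σ k (σ u) →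
  Reflects (σ k ≡ σ u) (Stats.cycMin σ k)
cycMin⇔closing {n} σ inj {k} {u} u≤k path = reflects-map onlyif if (cycMin-reflects σ k)
  where
  open Orbit σ inj
  onlyif : (∀ t → t ℕ.< n → ¬ Stats.iter σ t k < k) → σ k ≡ σ u
  onlyif min with path-length path
  ... | m , e with iter-back (m ℕ.+ 1) (trans (iter-+ m 1 u) e)
  ...   | t , e′ with iter-reduce k t
  ...     | r , r<n , e″ = cong σ (sym (Finₚ.≤-antisym u≤k
            (ℕₚ.≮⇒≥ (subst (λ x → ¬ x < k) (trans (sym e″) e′) (min r r<n)))))

  if : σ k ≡ σ u → ∀ t → t ℕ.< n → ¬ Stats.iter σ t k < k
  if e t _ = path-≥ (path-closed (subst (Path σ k) (sym e) path) t)

-- At a valley the value sought is the start of the path of decided arcs ending at `k`, found by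
-- going around the cycle of `k` in `τ`. Sending `k` there closes the cycle.
cycMin-uniqueChoice : UniqueChoice cycMinOrRecord
cycMin-uniqueChoice τ injτ k k<τk with Stats.preAbove τ k in above
... | false with record-uniqueChoice τ injτ k k<τk
...   | a , k<a , low , unique = a , k<a , low , λ σ injσ A →
  subst (λ b → Reflects (σ k ≡ a) (if b then Stats.cycMin σ k else Stats.isRec σ k))
    (sym (trans (preAbove-≡ A k) above)) (unique σ injσ A)
cycMin-uniqueChoice {n} τ injτ k k<τk | true = from-start start
  where
  start : ∃ λ u → Open τ k u × Path τ k (τ u)
  start with Orbit.period τ injτ k
  -- The walk starts at `τ k`, after the arc out of `k`. If it meets no open position, that arc
  -- itself was the last open one.
  ... | p , _ , e with path-start p (τ k) (trans (iter-shift τ p k) e)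
  ...   | inj₁ path  = k , (ℕₚ.≤-refl , k<τk) , path
  ...   | inj₂ found = found

  from-start : (∃ λ u → Open τ k u × Path τ k (τ u)) → ∃ λ a → k < a × (∃ λ u → u ≤ k × τ u ≡ a) ×
    (∀ σ → Inj σ → Agree (suc (toℕ k)) σ τ → Reflects (σ k ≡ a) (cycMinOrRecord σ k))
  from-start (u , (u≤k , u<τu) , path) =
    τ u , ℕₚ.≤∧≢⇒< (ℕₚ.≮⇒≥ (path-≥ path)) k≢τu , (u , u≤k , refl) , closing
    where
    -- This is where `k` being a valley enters: its preimage lies above `k`, whereas `u` does not.
    k≢τu : toℕ k ≢ toℕ (τ u)
    k≢τu e with reflects-sound (preAbove-reflects τ k) above
    ... | j , τj≡k , k<j = ℕₚ.<⇒≱ k<j (subst (_≤ k) (injτ (trans (sym (toℕ-injective e)) (sym τj≡k))) u≤k)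

    closing : ∀ σ → Inj σ → Agree (suc (toℕ k)) σ τ → Reflects (σ k ≡ τ u) (cycMinOrRecord σ k)
    closing σ injσ A with agree-low-values injτ injσ (agree-sym A) u≤k
    ... | u′ , u′≤k , e =
      subst₂ (λ a b → Reflects (σ k ≡ a) (if b then Stats.cycMin σ k else Stats.isRec σ k))
        e (sym (trans (preAbove-≡ A k) above))
        (cycMin⇔closing σ injσ u′≤k (subst (Path σ k) (sym e) (path-agree A path)))

-- Choosing a value by a transposition

module Redirect {n} (τ : Fin n → Fin n) (injτ : Inj τ) (k a : Fin n) where

  -- The values `a` and `τ k` are exchanged rather than `a` assigned to `k`, so that the result is
  -- again a permutation.
  redirect : Fin n → Fin n
  redirect j = transpose a (τ k) (τ j)

  redirect-injective : Inj redirect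
  redirect-injective {i} {j} e = injτ (begin
    τ i                                            ≡⟨ transpose-inverse (τ k) a ⟨
    transpose (τ k) a (transpose a (τ k) (τ i))    ≡⟨ cong (transpose (τ k) a) e ⟩
    transpose (τ k) a (transpose a (τ k) (τ j))    ≡⟨ transpose-inverse (τ k) a ⟩
    τ j                                            ∎)
    where open ≡-Reasoning

  redirect-k : redirect k ≡ a
  redirect-k with τ k ≟ a
  ... | yes e = e
  ... | no _ with τ k ≟ τ k
  ...   | yes _ = refl
  ...   | no ne = contradiction refl ne

  redirect-a : ∀ {j} → τ j ≡ a → redirect j ≡ τ k
  redirect-a {j} e with τ j ≟ a
  ... | yes _ = refl
  ... | no ne = contradiction e ne

  redirect-other : ∀ {j} → j ≢ k → τ j ≢ a → redirect j ≡ τ j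
  redirect-other {j} j≢k ne with τ j ≟ a
  ... | yes e = contradiction e ne
  ... | no _ with τ j ≟ τ k
  ...   | yes e = contradiction (injτ e) j≢k
  ...   | no _  = refl

  module _ (k<τk : k < τ k) (k<a : k < a) where

    -- With its converse below, this identifies the members of the class of `τ` at level k + 1 that
    -- take `a` at `k` with the class of `redirect` at level k. Only `k` and the old holder of `a`
    -- change arcs, and both arcs remain excedances because `a` and `τ k` exceed `k`.
    agree-redirect⇒ : (∀ {j} → τ j ≡ a → j ≤ k) → ∀ {σ} →
      Agree (toℕ k) σ redirect → Agree (suc (toℕ k)) σ τ × σ k ≡ a
    agree-redirect⇒ low {σ} A = agree , σk
      where
      σk : σ k ≡ a
      σk = trans (agree-above A ℕₚ.≤-refl) redirect-k

      agree : Agree (suc (toℕ k)) σ τ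
      agree j with j ≟ k
      ... | yes refl = inj₂ (ℕₚ.≤-refl , subst (k <_) (sym σk) k<a , k<τk)
      ... | no j≢k with τ j ≟ a
      ...   | no ne = subst (AgreeAt (suc (toℕ k)) j (σ j))
                        (redirect-other j≢k ne) (agree-mono (ℕₚ.n≤1+n _) A j)
      ...   | yes e = inj₂ (s≤s (low e)
                           , [ (λ eq → subst (j <_) (sym (trans eq (redirect-a e))) (ℕₚ.≤-<-trans (low e) k<τk))
                             , (λ (_ , lt , _) → lt) ]′ (A j)
                           , subst (j <_) (sym e) (ℕₚ.≤-<-trans (low e) k<a))

    agree-redirect⇐ : (∀ {j} → τ j ≡ a → j ≤ k) → ∀ {σ} → Inj σ →
      Agree (suc (toℕ k)) σ τ → σ k ≡ a → Agree (toℕ k) σ redirect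
    agree-redirect⇐ low {σ} injσ A σk j = at (j ≟ k) (τ j ≟ a)
      where
      at : Dec (j ≡ k) → Dec (τ j ≡ a) → AgreeAt (toℕ k) j (σ j) (redirect j)
      at (yes refl) _ = inj₁ (trans σk (sym redirect-k))
      at (no j≢k) (no ne) = subst (AgreeAt (toℕ k) j (σ j)) (sym (redirect-other j≢k ne))
        ([ inj₁ , (λ (j≤k , r) → inj₂ (ℕₚ.≤∧≢⇒< (ℕ.s≤s⁻¹ j≤k) (j≢k ∘ toℕ-injective) , r)) ]′ (A j))
      -- `σ` already takes `a` at `k`, so by injectivity the old holder of `a` cannot keep it and
      -- its arc is an undecided one.
      at (no j≢k) (yes e) = subst (AgreeAt (toℕ k) j (σ j)) (sym (redirect-a e))
        ([ (λ e′ → contradiction (injσ (trans e′ (trans e (sym σk)))) j≢k)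
         , (λ (j≤k , lt , _) → inj₂ ( ℕₚ.≤∧≢⇒< (ℕ.s≤s⁻¹ j≤k) (j≢k ∘ toℕ-injective)
                                    , lt , ℕₚ.≤-<-trans (ℕ.s≤s⁻¹ j≤k) k<τk)) ]′ (A j))

-- After `k` the two permutations coincide, so the value of `σ` at `k` cannot be held there by `τ`.
-- The split of a class by the value at `k` is therefore exhausted by the available values.
agree-value-at : ∀ {n} {σ τ : Fin n → Fin n} → Inj σ → ∀ {k} → k < τ k →
  Agree (suc (toℕ k)) σ τ → k < σ k × (∀ {j} → τ j ≡ σ k → j ≤ k)
agree-value-at {σ = σ} {τ} injσ {k} k<τk A = agree-excedance (agree-sym A) k<τk , low
  where
  low : ∀ {j} → τ j ≡ σ k → j ≤ k
  low {j} e with j Fin.≤? k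
  ... | yes le = le
  ... | no nle = contradiction (ℕₚ.≤-reflexive (cong toℕ (injσ (trans (agree-above A (ℕₚ.≰⇒> nle)) e)))) nle

-- Finite sums over lists and indices

module _ {a ℓ} (M : CommutativeMonoid a ℓ) where
  open CommutativeMonoid M hiding (refl; sym) renaming (trans to ≈-trans)
  open Algebra.Properties.CommutativeMonoid.Sum M

  sum-zero : ∀ {n} {f : Fin n → Carrier} → (∀ j → f j ≈ ε) → sum f ≈ ε
  sum-zero {n} h = ≈-trans (sum-cong-≋ h) (sum-replicate-zero n)

  sum-single : ∀ {n} {f : Fin n → Carrier} i → (∀ j → j ≢ i → f j ≈ ε) → sum f ≈ f i
  sum-single zero    h = ≈-trans (∙-congˡ (sum-zero λ j → h (suc j) λ ())) (identityʳ _)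
  sum-single (suc i) h = ≈-trans
    (∙-cong (h zero λ ()) (sum-single i λ j ne → h (suc j) (ne ∘ Finₚ.suc-injective))) (identityˡ _)

isInjective-reflects : ∀ {n} (v : Vec (Fin n) n) → Reflects (Inj (lookup v)) (isInjective v)
isInjective-reflects v = reflects-map (λ h {i} {j} → h i j) (λ h i j → h {i} {j})
  (all-tabulate-reflects id λ i → all-tabulate-reflects id λ j →
    eqF-reflects (lookup v i) (lookup v j) →-reflects eqF-reflects i j)

module _ {c ℓ} (R : CommutativeSemiring c ℓ) where
  open CommutativeSemiring R hiding (zero) renaming (refl to ≈-refl; sym to ≈-sym; trans to ≈-trans)
  open Poly R
  open Relation.Binary.Reasoning.Setoid setoid
  module Sum = Algebra.Properties.Semiring.Sum semiring
  module Prod = Algebra.Properties.CommutativeMonoid.Sum *-commutativeMonoid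
  open Sum using (sum)
  open Prod using () renaming (sum to prod)
  open Algebra.Definitions.RawMonoid +-rawMonoid using () renaming (_×_ to _·_)

  ind : Bool → Carrier → Carrier
  ind b x = if b then x else 0#

  ind-cong : ∀ {p} {P : Set p} {b x y} → Reflects P b → (P → x ≈ y) → ind b x ≈ ind b y
  ind-cong (ofʸ p) h = h p
  ind-cong (ofⁿ _) h = ≈-refl

  ind-∧ : ∀ a b x → ind a (ind b x) ≈ ind (a ∧ b) x
  ind-∧ true  b x = ≈-refl
  ind-∧ false b x = ≈-refl

  ind-*ˡ : ∀ y b x → ind b (y * x) ≈ y * ind b x
  ind-*ˡ y true  x = ≈-refl
  ind-*ˡ y false x = ≈-sym (zeroʳ y)

  ind-*ʳ : ∀ b x y → ind b (x * y) ≈ ind b x * y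
  ind-*ʳ true  x y = ≈-refl
  ind-*ʳ false x y = ≈-sym (zeroˡ y)

  sum-ind : ∀ {n} (p : Fin n → Bool) x → sum (λ i → ind (p i) x) ≈ # p · x
  sum-ind {zero}  p x = ≈-refl
  sum-ind {suc n} p x with p zero
  ... | true  = +-congˡ (sum-ind (p ∘ suc) x)
  ... | false = ≈-trans (+-identityˡ _) (sum-ind (p ∘ suc) x)

  sum-≡-ind : ∀ {n} (a : Fin n) x → sum (λ b → ind (does (b ≟ a)) x) ≈ x
  sum-≡-ind a x = ≈-trans (sum-single +-commutativeMonoid a other) at
    where
    other : ∀ b → b ≢ a → ind (does (b ≟ a)) x ≈ 0#
    other b ne with b ≟ a
    ... | yes e = contradiction e ne
    ... | no _  = ≈-refl
    at : ind (does (a ≟ a)) x ≈ x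
    at with a ≟ a
    ... | yes _ = ≈-refl
    ... | no ne = contradiction refl ne

  ΣL : ∀ {A : Set} → List A → (A → Carrier) → Carrier
  ΣL xs f = sumL (map f xs)

  module _ {A : Set} where

    ΣL-cong : ∀ (xs : List A) {f g : A → Carrier} → (∀ x → f x ≈ g x) → ΣL xs f ≈ ΣL xs g
    ΣL-cong []       h = ≈-refl
    ΣL-cong (x ∷ xs) h = +-cong (h x) (ΣL-cong xs h)

    ΣL-zero : ∀ (xs : List A) {f : A → Carrier} → (∀ x → f x ≈ 0#) → ΣL xs f ≈ 0#
    ΣL-zero []       h = ≈-refl
    ΣL-zero (x ∷ xs) h = ≈-trans (+-cong (h x) (ΣL-zero xs h)) (+-identityˡ 0#)

    ΣL-*ˡ : ∀ (xs : List A) y {f : A → Carrier} → ΣL xs (λ x → y * f x) ≈ y * ΣL xs f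
    ΣL-*ˡ []       y = ≈-sym (zeroʳ y)
    ΣL-*ˡ (x ∷ xs) y = ≈-trans (+-congˡ (ΣL-*ˡ xs y)) (≈-sym (distribˡ y _ _))

    ΣL-sum : ∀ {n} (xs : List A) (f : A → Fin n → Carrier) →
      ΣL xs (λ x → sum (f x)) ≈ sum (λ a → ΣL xs (λ x → f x a))
    ΣL-sum {n} []   f = ≈-sym (Sum.sum-replicate-zero n)
    ΣL-sum (x ∷ xs) f = ≈-trans (+-congˡ (ΣL-sum xs f)) (≈-sym (Sum.∑-distrib-+ (f x) _))

    ΣL-filter : ∀ {p} {P : A → Set p} (P? : ∀ x → Dec (P x)) (xs : List A) {f : A → Carrier} →
      ΣL (filter P? xs) f ≈ ΣL xs (λ x → ind (does (P? x)) (f x))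
    ΣL-filter P? []       = ≈-refl
    ΣL-filter P? (x ∷ xs) with does (P? x)
    ... | true  = +-congˡ (ΣL-filter P? xs)
    ... | false = ≈-trans (ΣL-filter P? xs) (≈-sym (+-identityˡ _))

    ΣL-++ : ∀ (xs ys : List A) {f : A → Carrier} → ΣL (xs ++ ys) f ≈ ΣL xs f + ΣL ys f
    ΣL-++ []       ys = ≈-sym (+-identityˡ _)
    ΣL-++ (x ∷ xs) ys = ≈-trans (+-congˡ (ΣL-++ xs ys)) (≈-sym (+-assoc _ _ _))

    ΣL-tabulate : ∀ {n} (g : Fin n → A) {f : A → Carrier} → ΣL (tabulate g) f ≈ sum (f ∘ g)
    ΣL-tabulate {zero}  g = ≈-refl
    ΣL-tabulate {suc n} g = +-congˡ (ΣL-tabulate (g ∘ suc))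

  ΣL-map : ∀ {A B : Set} (h : A → B) (xs : List A) {f : B → Carrier} → ΣL (map h xs) f ≈ ΣL xs (f ∘ h)
  ΣL-map h xs = reflexive (cong sumL (sym (map-∘ xs)))

  ΣL-concatMap : ∀ {A B : Set} (h : A → List B) (xs : List A) {f : B → Carrier} →
    ΣL (concatMap h xs) f ≈ ΣL xs (λ x → ΣL (h x) f)
  ΣL-concatMap h []       = ≈-refl
  ΣL-concatMap h (x ∷ xs) = ≈-trans (ΣL-++ (h x) _) (+-congˡ (ΣL-concatMap h xs))

  -- One coordinate is peeled off at a time, and only the branch with the head of `u` survives. It
  -- evaluates the class at level 0, which has a single member.
  ΣL-allVecs-single : ∀ {n m} (p : Vec (Fin n) m → Bool) u → p u ≡ true →
    (∀ v → p v ≡ true → v ≡ u) → ΣL (allVecs n m) (λ v → ind (p v) 1#) ≈ 1#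
  ΣL-allVecs-single {n} {zero} p [] pu unique rewrite pu = +-identityʳ 1#
  ΣL-allVecs-single {n} {suc m} p (b ∷ u) pu unique = begin
    ΣL (allVecs n (suc m)) (λ v → ind (p v) 1#)
      ≈⟨ ΣL-concatMap (λ a → map (a ∷_) (allVecs n m)) (tabulate id) ⟩
    ΣL (tabulate id) (λ a → ΣL (map (a ∷_) (allVecs n m)) (λ v → ind (p v) 1#))
      ≈⟨ ΣL-tabulate {n = n} id ⟩
    sum (λ a → ΣL (map (a ∷_) (allVecs n m)) (λ v → ind (p v) 1#))
      ≈⟨ Sum.sum-cong-≋ {n} (λ a → ΣL-map (a ∷_) (allVecs n m)) ⟩
    sum (λ a → ΣL (allVecs n m) (λ v → ind (p (a ∷ v)) 1#))
      ≈⟨ sum-single +-commutativeMonoid b (λ a a≢b → ΣL-zero (allVecs n m) λ v → vanish a a≢b v) ⟩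
    ΣL (allVecs n m) (λ v → ind (p (b ∷ v)) 1#)
      ≈⟨ ΣL-allVecs-single (λ v → p (b ∷ v)) u pu (λ v pv → cong Vec.tail (unique (b ∷ v) pv)) ⟩
    1# ∎
    where
    vanish : ∀ a → a ≢ b → ∀ v → ind (p (a ∷ v)) 1# ≈ 0#
    vanish a a≢b v with p (a ∷ v) in e
    ... | true  = contradiction (cong Vec.head (unique (a ∷ v) e)) a≢b
    ... | false = ≈-refl

  module _ {A : Set} {_~_ : A → A → Set} (_~?_ : ∀ x y → Dec (x ~ y))
    (~-refl : ∀ x → x ~ x) (~-sym : ∀ {x y} → x ~ y → y ~ x) (~-trans : ∀ {x y z} → x ~ y → y ~ z → x ~ z) where

    -- The class of the head is split off and the rest filtered. This avoids enumerating the
    -- possible sets of non-excedance arcs: each class is represented by one of its own members.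
    ΣL-by-classes : ∀ (xs : List A) {f g : A → Carrier} →
      (∀ y → y ∈ xs → ΣL xs (λ x → ind (does (x ~? y)) (f x)) ≈ ΣL xs (λ x → ind (does (x ~? y)) (g x))) →
      ΣL xs f ≈ ΣL xs g
    ΣL-by-classes xs = go (length xs) xs ℕₚ.≤-refl
      where
      split : ∀ y (xs : List A) (f : A → Carrier) →
        ΣL xs f ≈ ΣL xs (λ x → ind (does (x ~? y)) (f x)) + ΣL (filter (λ x → ¬? (x ~? y)) xs) f
      split y []       f = ≈-sym (+-identityˡ 0#)
      split y (x ∷ xs) f with does (x ~? y)
      ... | true  = ≈-trans (+-congˡ (split y xs f)) (≈-sym (+-assoc _ _ _))
      ... | false = ≈-trans (+-congˡ (split y xs f)) (≈-trans (≈-sym (+-assoc _ _ _))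
                      (≈-trans (+-congʳ (+-comm _ _)) (≈-trans (+-assoc _ _ _) (+-congʳ (≈-sym (+-identityˡ _))))))

      restrict : ∀ {y y′} (xs : List A) (f : A → Carrier) → ¬ (y′ ~ y) →
        ΣL (filter (λ x → ¬? (x ~? y)) xs) (λ x → ind (does (x ~? y′)) (f x)) ≈ ΣL xs (λ x → ind (does (x ~? y′)) (f x))
      restrict {y} {y′} xs f y′≁y = ≈-trans (ΣL-filter (λ x → ¬? (x ~? y)) xs) (ΣL-cong xs λ x →
        ≈-trans (ind-∧ (not (does (x ~? y))) (does (x ~? y′)) (f x)) (reflexive (cong (λ b → ind b (f x))
          (reflects-≡ (¬-reflects (proof (x ~? y)) ×-reflects proof (x ~? y′)) (proof (x ~? y′))
            proj₂ (λ x~y′ → (λ x~y → y′≁y (~-trans (~-sym x~y′) x~y)) , x~y′)))))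

      -- Recursion is on a bound for the length, since the filtered list is not a structural part of
      -- the original one.
      go : ∀ m (xs : List A) → length xs ℕ.≤ m → ∀ {f g : A → Carrier} →
        (∀ y → y ∈ xs → ΣL xs (λ x → ind (does (x ~? y)) (f x)) ≈ ΣL xs (λ x → ind (does (x ~? y)) (g x))) →
        ΣL xs f ≈ ΣL xs g
      go m       []       _   h = ≈-refl
      go (suc m) (y ∷ ys) len {f} {g} h =
        ≈-trans (split y zs f) (≈-trans (+-cong (h y (here refl)) rest) (≈-sym (split y zs g)))
        where
        zs = y ∷ ys
        P? = λ x → ¬? (x ~? y)
        rest : ΣL (filter P? zs) f ≈ ΣL (filter P? zs) g
        rest = go m (filter P? zs)
          (ℕ.s≤s⁻¹ (ℕₚ.≤-trans (filter-notAll P? zs (here λ ne → ne (~-refl y))) len))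
          λ y′ y′∈ → let y′∈xs , y′≁y = ∈-filter⁻ P? {xs = zs} y′∈ in
            ≈-trans (restrict zs f y′≁y) (≈-trans (h y′ y′∈xs) (≈-sym (restrict zs g y′≁y)))

  -- Products over an initial segment of positions

  -- A product over all indices with units from `m` on, so that the index type stays fixed while the
  -- level varies.
  prodBelow : ∀ {n} → ℕ → (Fin n → Carrier) → Carrier
  prodBelow m f = prod λ i → if toℕ i <ᵇ m then f i else 1#

  prodBelow-zero : ∀ {n} (f : Fin n → Carrier) → prodBelow 0 f ≈ 1#
  prodBelow-zero {n} f = Prod.sum-replicate-zero n

  prodBelow-suc : ∀ {n} (f : Fin n → Carrier) k → prodBelow (suc (toℕ k)) f ≈ f k * prodBelow (toℕ k) f
  prodBelow-suc {n} f k = begin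
    prodBelow (suc (toℕ k)) f
      ≈⟨ Prod.sum-cong-≋ {n} factor ⟩
    prod (λ i → (if does (i ≟ k) then f i else 1#) * (if toℕ i <ᵇ toℕ k then f i else 1#))
      ≈⟨ Prod.∑-distrib-+ (λ i → if does (i ≟ k) then f i else 1#) _ ⟩
    prod (λ i → if does (i ≟ k) then f i else 1#) * prodBelow (toℕ k) f
      ≈⟨ *-congʳ (≈-trans (sum-single *-commutativeMonoid k other) at) ⟩
    f k * prodBelow (toℕ k) f ∎
    where
    other : ∀ j → j ≢ k → (if does (j ≟ k) then f j else 1#) ≈ 1#
    other j ne with j ≟ k
    ... | yes e = contradiction e ne
    ... | no _  = ≈-refl
    at : (if does (k ≟ k) then f k else 1#) ≈ f k
    at with k ≟ k
    ... | yes _ = ≈-refl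
    ... | no ne = contradiction refl ne
    factor : ∀ i → (if toℕ i <ᵇ suc (toℕ k) then f i else 1#) ≈
      (if does (i ≟ k) then f i else 1#) * (if toℕ i <ᵇ toℕ k then f i else 1#)
    factor i with i ≟ k
    ... | yes refl rewrite reflects-true (<ᵇ-reflects (toℕ k) (suc (toℕ k))) (ℕₚ.n<1+n _)
                           | reflects-false (<ᵇ-reflects (toℕ k) (toℕ k)) (ℕₚ.<-irrefl refl) = ≈-sym (*-identityʳ _)
    ... | no ne = ≈-trans (reflexive (cong (if_then f i else 1#)
        (reflects-≡ (<ᵇ-reflects (toℕ i) (suc (toℕ k))) (<ᵇ-reflects (toℕ i) (toℕ k))
          (λ lt → ℕₚ.≤∧≢⇒< (ℕ.s≤s⁻¹ lt) (ne ∘ toℕ-injective)) (λ lt → ℕₚ.m<n⇒m<1+n lt)))) (≈-sym (*-identityˡ _))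

  prodBelow-all : ∀ {n} (f : Fin n → Carrier) → prodBelow n f ≈ prod f
  prodBelow-all {n} f = Prod.sum-cong-≋ {n} λ i →
    reflexive (cong (if_then f i else 1#) (reflects-true (<ᵇ-reflects (toℕ i) n) (toℕ<n i)))

  prodBelow-cong : ∀ {n} m {f g : Fin n → Carrier} → (∀ i → f i ≈ g i) → prodBelow m f ≈ prodBelow m g
  prodBelow-cong {n} m {f} {g} h = Prod.sum-cong-≋ {n} λ i → branch (toℕ i <ᵇ m) (h i)
    where
    branch : ∀ b {x y} → x ≈ y → (if b then x else 1#) ≈ (if b then y else 1#)
    branch true  e = e
    branch false e = ≈-refl

  -- Summands as products of local weights

  module Weights (x₁ x₂ y₁ y₂ u₁ u₂ v₁ v₂ : Carrier) (w : ℕ → Carrier) where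

    when : Bool → Carrier → Carrier
    when b x = if b then x else 1#

    -- The contribution of one index, in the order of the factors of a summand. `val` and `nval`
    -- stay open to serve both polynomials: cycle minimum and its negation for one, exclusive record
    -- and neither for the other.
    factor : (pb pa lt gt rec arec fix val nval : Bool) → Carrier → Carrier
    factor pb pa lt gt rec arec fix val nval z =
        when ((pb ∧ gt) ∧ (arec ∧ not rec)) x₁ * when ((pa ∧ gt) ∧ (arec ∧ not rec)) x₂
      * when ((pa ∧ lt) ∧ val) y₁ * when ((pb ∧ lt) ∧ (rec ∧ not arec)) y₂
      * when ((pb ∧ gt) ∧ (not rec ∧ not arec)) u₁ * when ((pa ∧ gt) ∧ (not rec ∧ not arec)) u₂
      * when ((pa ∧ lt) ∧ nval) v₁ * when ((pb ∧ lt) ∧ (not rec ∧ not arec)) v₂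
      * when fix z

    factor-excedance : ∀ pa rec s z → factor (not pa) pa true false rec false false s (not s) z ≈
      (if (if pa then s else rec) then (if pa then y₁ else y₂) else (if pa then v₁ else v₂))
    factor-excedance pa rec s z = cases pa rec s
      where
      -- In each case one variable survives among nine factors: in `cases`, `one₂`, `one₃`, `one₆`
      -- and `one₇` remove that many units before it, and each `pad` removes one after it.
      pad : ∀ {x y} → x ≈ y → x * 1# ≈ y
      pad e = ≈-trans (*-identityʳ _) e
      unit : ∀ {e x} → e ≈ 1# → e * x ≈ x
      unit e = ≈-trans (*-congʳ e) (*-identityˡ _)
      one₂ : ∀ {x} → 1# * 1# * x ≈ x
      one₂ = unit (*-identityʳ 1#)
      one₃ : ∀ {x} → 1# * 1# * 1# * x ≈ x
      one₃ = unit one₂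
      one₆ : ∀ {x} → 1# * 1# * 1# * 1# * 1# * 1# * x ≈ x
      one₆ = unit (pad (pad one₃))
      one₇ : ∀ {x} → 1# * 1# * 1# * 1# * 1# * 1# * 1# * x ≈ x
      one₇ = unit one₆
      cases : ∀ pa rec s → factor (not pa) pa true false rec false false s (not s) z ≈
        (if (if pa then s else rec) then (if pa then y₁ else y₂) else (if pa then v₁ else v₂))
      cases true  rec   true  = pad (pad (pad (pad (pad (pad one₂)))))
      cases true  rec   false = pad (pad one₆)
      cases false true  s     = pad (pad (pad (pad (pad one₃))))
      cases false false s     = pad one₇

    factor-nonexcedance : ∀ pb pa gt rec arec fix val nval z →
      factor pb pa false gt rec arec fix val nval z ≡ factor pb pa false gt rec arec fix false false z
    factor-nonexcedance pb true  gt rec arec fix val nval z = refl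
    factor-nonexcedance pb false gt rec arec fix val nval z = refl

    factor-fixed : ∀ pb pa rec arec z →
      factor pb pa false false rec arec true false false z ≡
      factor false false false false false false true false false z
    factor-fixed true  true  rec arec z = refl
    factor-fixed true  false rec arec z = refl
    factor-fixed false true  rec arec z = refl
    factor-fixed false false rec arec z = refl

    module _ {n} (σ : Fin n → Fin n) where
      open Stats σ

      special plain base : Fin n → Carrier
      special i = if preAbove i then y₁ else y₂
      plain   i = if preAbove i then v₁ else v₂
      base    i = factor (preBelow i) (preAbove i) false (ltF (σ i) i) (isRec i) (isArec i) (fixpt i)
                         false false (w (psnest i))

      local : (Fin n → Bool) → Fin n → Carrier
      local sp i = if ltF i (σ i) then (if sp i then special i else plain i) else base i

      -- down (suc i) σ is the number of possible values at i, one of which gets the special weight.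
      averaged : Fin n → Carrier
      averaged i = if ltF i (σ i) then special i + (down (suc (toℕ i)) σ ∸ 1) · plain i else base i

      pow-count : ∀ x (p : Fin n → Bool) → pow x (countF n p) ≈ prod (λ i → when (p i) x)
      pow-count x p = go id
        where
        go : ∀ {m} (f : Fin m → Fin n) → pow x (length (filterᵇ p (tabulate f))) ≈ prod (λ i → when (p (f i)) x)
        go {zero}  f = ≈-refl
        go {suc m} f with p (f zero)
        ... | true  = *-congˡ (go (f ∘ suc))
        ... | false = ≈-trans (go (f ∘ suc)) (≈-sym (*-identityˡ _))

      wfix-prod : wfix w σ ≈ prod (λ i → when (fixpt i) (w (psnest i)))
      wfix-prod = go id
        where
        go : ∀ {m} (f : Fin m → Fin n) →
          prodL (map (λ i → w (psnest i)) (filterᵇ fixpt (tabulate f))) ≈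
          prod (λ i → when (fixpt (f i)) (w (psnest (f i))))
        go {zero}  f = ≈-refl
        go {suc m} f with fixpt (f zero)
        ... | true  = *-congˡ (go (f ∘ suc))
        ... | false = ≈-trans (go (f ∘ suc)) (≈-sym (*-identityˡ _))

      term-prod : (val nval : Fin n → Bool) →
        pow x₁ eareccpeak * pow x₂ eareccdfall * pow y₁ (countF n (λ i → cval i ∧ val i)) * pow y₂ ereccdrise
        * pow u₁ nrcpeak * pow u₂ nrcdfall * pow v₁ (countF n (λ i → cval i ∧ nval i)) * pow v₂ nrcdrise * wfix w σ
        ≈ prod (λ i → factor (preBelow i) (preAbove i) (ltF i (σ i)) (ltF (σ i) i) (isRec i) (isArec i) (fixpt i)
                         (val i) (nval i) (w (psnest i)))
      term-prod val nval =
        pow-count x₁ _ ⊗ pow-count x₂ _ ⊗ pow-count y₁ _ ⊗ pow-count y₂ _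
        ⊗ pow-count u₁ _ ⊗ pow-count u₂ _ ⊗ pow-count v₁ _ ⊗ pow-count v₂ _ ⊗ wfix-prod
        where
        infixl 7 _⊗_
        _⊗_ : ∀ {a b} {f g : Fin n → Carrier} → a ≈ prod f → b ≈ prod g → a * b ≈ prod (λ i → f i * g i)
        _⊗_ {f = f} {g} p q = ≈-trans (*-cong p q) (≈-sym (Prod.∑-distrib-+ f g))

      -- The condition on `val` and `nval` is imposed at excedances only, because exclusive records
      -- agree with records only away from antirecords.
      factor-local : Inj σ → (s val nval : Fin n → Bool) → (∀ i → i < σ i → val i ≡ s i × nval i ≡ not (s i)) → ∀ i →
        factor (preBelow i) (preAbove i) (ltF i (σ i)) (ltF (σ i) i) (isRec i) (isArec i) (fixpt i)
          (val i) (nval i) (w (psnest i))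
        ≈ local (λ i → if preAbove i then s i else isRec i) i
      factor-local inj s val nval h i with ltF i (σ i) | ltF-reflects i (σ i)
      ... | false | _ = reflexive
        (factor-nonexcedance (preBelow i) (preAbove i) (ltF (σ i) i) (isRec i) (isArec i) (fixpt i) (val i) (nval i) (w (psnest i)))
      ... | true  | ofʸ i<σi
        rewrite proj₁ (h i i<σi) | proj₂ (h i i<σi)
              | Bijection.preBelow≡¬preAbove σ inj i i<σi
              | reflects-false (ltF-reflects (σ i) i) (ℕₚ.<-asym i<σi)
              | reflects-false (isArec-reflects σ i) (Bijection.excedance-not-antirecord σ inj i i<σi)
              | reflects-false (eqF-reflects (σ i) i) (λ e → ℕₚ.<-irrefl (sym (cong toℕ e)) i<σi)
        = factor-excedance (preAbove i) (isRec i) (s i) (w (psnest i))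

    module _ {n k} {σ τ : Fin n → Fin n} (injσ : Inj σ) (injτ : Inj τ) (A : Agree k σ τ) where

      ltF-≡ : ∀ i → ltF i (σ i) ≡ ltF i (τ i)
      ltF-≡ i = reflects-≡ (ltF-reflects i (σ i)) (ltF-reflects i (τ i))
        (agree-excedance A) (agree-excedance (agree-sym A))

      -- Record status looks at earlier positions, whose excedance arcs may change; but a descent is
      -- never a record, so only antirecord status is left, and that is shared.
      base-descent : ∀ i → σ i < i → τ i < i → base σ i ≡ base τ i
      base-descent i σi<i τi<i
        rewrite preBelow-≡ injσ injτ A i | preAbove-≡ A i | isArec-≡ A i (ℕₚ.<⇒≤ σi<i)
              | reflects-false (isRec-reflects σ i) (Bijection.descent-not-record σ injσ i σi<i)
              | reflects-false (isRec-reflects τ i) (Bijection.descent-not-record τ injτ i τi<i)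
              | reflects-false (eqF-reflects (σ i) i) (λ e → ℕₚ.<-irrefl (cong toℕ e) σi<i)
              | reflects-false (eqF-reflects (τ i) i) (λ e → ℕₚ.<-irrefl (cong toℕ e) τi<i)
              | reflects-true (ltF-reflects (σ i) i) σi<i
              | reflects-true (ltF-reflects (τ i) i) τi<i
        = refl

      base-fixed : ∀ i → σ i ≡ i → τ i ≡ i → base σ i ≡ base τ i
      base-fixed i σi≡i τi≡i = trans (at-fixed σ σi≡i) (trans (cong fixed nest) (sym (at-fixed τ τi≡i)))
        where
        fixed : ℕ → Carrier
        fixed m = factor false false false false false false true false false (w m)
        nest : Stats.psnest σ i ≡ Stats.psnest τ i
        nest = trans (psnest≡down σ injσ i σi≡i) (trans (down-≡ A (toℕ i)) (sym (psnest≡down τ injτ i τi≡i)))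
        at-fixed : ∀ ρ → ρ i ≡ i → base ρ i ≡ fixed (Stats.psnest ρ i)
        at-fixed ρ fix rewrite reflects-false (ltF-reflects (ρ i) i) (ℕₚ.<-irrefl (cong toℕ fix))
                             | reflects-true (eqF-reflects (ρ i) i) fix
          = factor-fixed (Stats.preBelow ρ i) (Stats.preAbove ρ i) (Stats.isRec ρ i) (Stats.isArec ρ i)
              (w (Stats.psnest ρ i))

      base-≡ : ∀ i → σ i ≤ i → base σ i ≡ base τ i
      base-≡ i σi≤i with agree-nonexcedance A σi≤i | σ i ≟ i
      ... | σi≡τi | yes σi≡i = base-fixed i σi≡i (trans (sym σi≡τi) σi≡i)
      ... | σi≡τi | no σi≢i  = base-descent i σi<i (subst (_< i) σi≡τi σi<i)
        where
        σi<i : σ i < i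
        σi<i = ℕₚ.≤∧≢⇒< σi≤i (σi≢i ∘ toℕ-injective)

      -- This invariance lets all choices at one position share the same factor for the positions
      -- below it, although the permutation representing the choice varies.
      averaged-≡ : ∀ i → averaged σ i ≡ averaged τ i
      averaged-≡ i with ltF i (σ i) | ltF i (τ i) | ltF-≡ i | ltF-reflects i (σ i)
      ... | true  | _ | refl | _ rewrite preAbove-≡ A i | down-≡ A (suc (toℕ i)) = refl
      ... | false | _ | refl | ofⁿ i≮σi = base-≡ i (ℕₚ.≮⇒≥ i≮σi)

    -- The weighted sum over a class

    module ClassSum (sp : ∀ {n} → (Fin n → Fin n) → Fin n → Bool) (unique : UniqueChoice sp) {n : ℕ} where

      weight : ℕ → (Fin n → Fin n) → Carrier
      weight m σ = prodBelow m (local σ (sp σ))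

      inClass : ℕ → (Fin n → Fin n) → Vec (Fin n) n → Bool
      inClass m τ v = isInjective v ∧ does (agree? m (lookup v) τ)

      -- Summed over all vectors with an indicator, so that classes of different permutations and
      -- levels are compared term by term over one list.
      classSum : ℕ → (Fin n → Fin n) → Carrier
      classSum m τ = ΣL (allVecs n n) λ v → ind (inClass m τ v) (weight m (lookup v))

      inClass-reflects : ∀ m τ (v : Vec (Fin n) n) → Reflects (Inj (lookup v) × Agree m (lookup v) τ) (inClass m τ v)
      inClass-reflects m τ v = isInjective-reflects v ×-reflects proof (agree? m (lookup v) τ)

      classSum-zero : ∀ τ → Inj τ → classSum 0 τ ≈ 1#
      classSum-zero τ injτ = ≈-trans
        (ΣL-cong (allVecs n n) λ v → ind-cong (inClass-reflects 0 τ v)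
          λ _ → prodBelow-zero (local (lookup v) (sp (lookup v))))
        (ΣL-allVecs-single _ (Vec.tabulate τ)
          (reflects-true (inClass-reflects 0 τ (Vec.tabulate τ)) (inj′ , agree′)) only)
        where
        inj′ : Inj (lookup (Vec.tabulate τ))
        inj′ {i} {j} e = injτ (trans (sym (lookup∘tabulate τ i)) (trans e (lookup∘tabulate τ j)))
        agree′ : Agree 0 (lookup (Vec.tabulate τ)) τ
        agree′ j = inj₁ (lookup∘tabulate τ j)
        only : ∀ v → inClass 0 τ v ≡ true → v ≡ Vec.tabulate τ
        only v e = trans (sym (tabulate∘lookup v))
          (tabulate-cong λ j → agree-above (proj₂ (reflects-sound (inClass-reflects 0 τ v) e)) z≤n)

      -- There is nothing to choose at `k`: levels k and k + 1 give the same class, and the factor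
      -- at `k` is constant on it.
      classSum-suc-nonexcedance : ∀ τ → Inj τ → ∀ k → τ k ≤ k →
        classSum (toℕ k) τ ≈ prodBelow (toℕ k) (averaged τ) →
        classSum (suc (toℕ k)) τ ≈ prodBelow (suc (toℕ k)) (averaged τ)
      classSum-suc-nonexcedance τ injτ k τk≤k ih = begin
        classSum (suc (toℕ k)) τ
          ≈⟨ ΣL-cong (allVecs n n) (λ v → ≈-trans (reflexive (cong (λ b → ind b _) (same v)))
               (ind-cong (inClass-reflects (toℕ k) τ v)
                 (λ (injσ , A) → ≈-trans (prodBelow-suc _ k) (*-congʳ (at-k injσ A))))) ⟩
        ΣL (allVecs n n) (λ v → ind (inClass (toℕ k) τ v) (base τ k * weight (toℕ k) (lookup v)))
          ≈⟨ ΣL-cong (allVecs n n) (λ v → ind-*ˡ (base τ k) (inClass (toℕ k) τ v) _) ⟩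
        ΣL (allVecs n n) (λ v → base τ k * ind (inClass (toℕ k) τ v) (weight (toℕ k) (lookup v)))
          ≈⟨ ΣL-*ˡ (allVecs n n) (base τ k) ⟩
        base τ k * classSum (toℕ k) τ
          ≈⟨ *-cong (reflexive (sym (averaged-k))) ih ⟩
        averaged τ k * prodBelow (toℕ k) (averaged τ)
          ≈⟨ prodBelow-suc (averaged τ) k ⟨
        prodBelow (suc (toℕ k)) (averaged τ) ∎
        where
        not-excedance : ∀ {x} → x ≤ k → ltF k x ≡ false
        not-excedance {x} le = reflects-false (ltF-reflects k x) (ℕₚ.≤⇒≯ le)
        averaged-k : averaged τ k ≡ base τ k
        averaged-k rewrite not-excedance τk≤k = refl
        at-k : ∀ {σ} → Inj σ → Agree (toℕ k) σ τ → local σ (sp σ) k ≈ base τ k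
        at-k {σ} injσ A rewrite not-excedance {σ k} (subst (_≤ k) (agree-nonexcedance (agree-sym A) τk≤k) τk≤k)
          = reflexive (base-≡ injσ injτ A k (subst (_≤ k) (agree-nonexcedance (agree-sym A) τk≤k) τk≤k))
        lower : ∀ {σ} → Agree (suc (toℕ k)) σ τ → Agree (toℕ k) σ τ
        lower {σ} A j with A j
        ... | inj₁ e = inj₁ e
        ... | inj₂ (j≤k , lt , lt′) = inj₂ (ℕₚ.≤∧≢⇒< (ℕ.s≤s⁻¹ j≤k) j≢k , lt , lt′)
          where
          j≢k : toℕ j ≢ toℕ k
          j≢k e = ℕₚ.<⇒≱ lt′ (subst (λ i → τ i ≤ i) (sym (toℕ-injective e)) τk≤k)
        same : ∀ v → inClass (suc (toℕ k)) τ v ≡ inClass (toℕ k) τ v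
        same v = reflects-≡ (inClass-reflects (suc (toℕ k)) τ v) (inClass-reflects (toℕ k) τ v)
          (λ (inj , A) → inj , lower A) (λ (inj , A) → inj , agree-mono (ℕₚ.n≤1+n _) A)

      -- The induction hypothesis ranges over all permutations, since it is applied to a different
      -- `redirect` for each available value.
      module ExcedanceStep (τ : Fin n → Fin n) (injτ : Inj τ) (k : Fin n) (k<τk : k < τ k)
        (ih : ∀ τ → Inj τ → classSum (toℕ k) τ ≈ prodBelow (toℕ k) (averaged τ)) where
        open Bijection τ injτ

        choice : Fin n
        choice = proj₁ (unique τ injτ k k<τk)

        -- Phrased through `inv a`: reindexing the values by `τ` then turns their number into the
        -- number of arcs crossing the cut above `k` upwards.
        Available : Fin n → Set
        Available a = inv a ≤ k × ¬ a ≤ k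

        available : Fin n → Bool
        available a = (toℕ (inv a) <ᵇ suc (toℕ k)) ∧ not (toℕ a <ᵇ suc (toℕ k))

        ≤-reflects : ∀ (a : Fin n) → Reflects (a ≤ k) (toℕ a <ᵇ suc (toℕ k))
        ≤-reflects a = reflects-map ℕ.s≤s⁻¹ s≤s (<ᵇ-reflects _ _)

        available-reflects : ∀ a → Reflects (Available a) (available a)
        available-reflects a = ≤-reflects (inv a) ×-reflects ¬-reflects (≤-reflects a)

        available-choice : Available choice
        available-choice with unique τ injτ k k<τk
        ... | a , k<a , (u , u≤k , refl) , _ = subst (_≤ k) (sym (inv-σ u)) u≤k , ℕₚ.<⇒≱ k<a

        is-choice : Fin n → Bool
        is-choice a = does (a ≟ choice)

        chosen : Fin n → Carrier
        chosen a = if is-choice a then special τ k else plain τ k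

        #-available : # available ≡ down (suc (toℕ k)) τ
        #-available = trans (#-permute available)
          (trans (#-cong λ j → cong (λ i → (toℕ i <ᵇ suc (toℕ k)) ∧ not (toℕ (τ j) <ᵇ suc (toℕ k))) (inv-σ j))
            (up≡down (suc (toℕ k))))

        #-other : # (λ a → available a ∧ not (is-choice a)) ≡ down (suc (toℕ k)) τ ∸ 1
        #-other = cong (_∸ 1) (trans (cong (ℕ._+ # (λ a → available a ∧ not (is-choice a))) (sym one))
          (trans (sym (#-split available is-choice)) #-available))
          where
          -- `choice` is itself available, so exactly one value is split off and the truncated
          -- subtraction in `averaged` is exact.
          one : # (λ a → available a ∧ is-choice a) ≡ 1
          one = trans (sum-single ℕₚ.+-0-commutativeMonoid choice other) at
            where
            other : ∀ a → a ≢ choice → (if available a ∧ is-choice a then 1 else 0) ≡ 0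
            other a ne rewrite reflects-false (available-reflects a ×-reflects proof (a ≟ choice)) (ne ∘ proj₂) = refl
            at : (if available choice ∧ is-choice choice then 1 else 0) ≡ 1
            at rewrite reflects-true (available-reflects choice ×-reflects proof (choice ≟ choice))
                                     (available-choice , refl) = refl

        sum-chosen : sum (λ a → ind (available a) (chosen a)) ≈ averaged τ k
        sum-chosen = begin
          sum (λ a → ind (available a) (chosen a))
            ≈⟨ Sum.sum-cong-≋ {n} (λ a → split a) ⟩
          sum (λ a → ind (is-choice a) (special τ k) + ind (available a ∧ not (is-choice a)) (plain τ k))
            ≈⟨ Sum.∑-distrib-+ {n} (λ a → ind (is-choice a) (special τ k)) _ ⟩
          sum (λ a → ind (is-choice a) (special τ k)) + sum (λ a → ind (available a ∧ not (is-choice a)) (plain τ k))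
            ≈⟨ +-cong (sum-≡-ind choice _) (sum-ind (λ a → available a ∧ not (is-choice a)) _) ⟩
          special τ k + # (λ a → available a ∧ not (is-choice a)) · plain τ k
            ≡⟨ cong (λ m → special τ k + m · plain τ k) #-other ⟩
          special τ k + (down (suc (toℕ k)) τ ∸ 1) · plain τ k
            ≡⟨ averaged-k ⟨
          averaged τ k ∎
          where
          averaged-k : averaged τ k ≡ special τ k + (down (suc (toℕ k)) τ ∸ 1) · plain τ k
          averaged-k rewrite reflects-true (ltF-reflects k (τ k)) k<τk = refl
          split : ∀ a → ind (available a) (chosen a) ≈
            ind (is-choice a) (special τ k) + ind (available a ∧ not (is-choice a)) (plain τ k)
          split a with a ≟ choice
          ... | no _ with available a
          ...   | true  = ≈-sym (+-identityˡ _)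
          ...   | false = ≈-sym (+-identityˡ _)
          split a | yes refl rewrite reflects-true (available-reflects choice) available-choice = ≈-sym (+-identityʳ _)

        chosen-local : ∀ {σ a} → Inj σ → Agree (suc (toℕ k)) σ τ → σ k ≡ a → local σ (sp σ) k ≡ chosen a
        chosen-local {σ} injσ A refl
          rewrite reflects-true (ltF-reflects k (σ k)) (agree-excedance (agree-sym A) k<τk)
                | preAbove-≡ A k
                | reflects-≡ (proj₂ (proj₂ (proj₂ (unique τ injτ k k<τk))) σ injσ A) (proof (σ k ≟ choice)) id id
          = refl

        summand : Fin n → Vec (Fin n) n → Carrier
        summand a v = ind (does (a ≟ lookup v k)) (ind (inClass (suc (toℕ k)) τ v) (weight (suc (toℕ k)) (lookup v)))

        sum-at : ∀ a → ΣL (allVecs n n) (summand a) ≈ ind (available a) (chosen a * prodBelow (toℕ k) (averaged τ))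
        sum-at a with available a | available-reflects a
        ... | false | ofⁿ ¬av = ΣL-zero (allVecs n n) λ v →
          ≈-trans (ind-∧ (does (a ≟ lookup v k)) _ _)
            (reflexive (cong (λ b → ind b (weight (suc (toℕ k)) (lookup v)))
              (reflects-false (proof (a ≟ lookup v k) ×-reflects inClass-reflects (suc (toℕ k)) τ v)
                λ { (refl , inj , A) → let k<σk , low = agree-value-at inj k<τk A in
                      ¬av (low (σ-inv _) , ℕₚ.<⇒≱ k<σk) })))
        ... | true | ofʸ (low , a≰k) = begin
          ΣL (allVecs n n) (summand a)
            ≈⟨ ΣL-cong (allVecs n n) (λ v → ≈-trans (ind-∧ (does (a ≟ lookup v k)) _ _)
                 (reflexive (cong (λ b → ind b (weight (suc (toℕ k)) (lookup v))) (same v)))) ⟩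
          ΣL (allVecs n n) (λ v → ind (inClass (toℕ k) redirect v) (weight (suc (toℕ k)) (lookup v)))
            ≈⟨ ΣL-cong (allVecs n n) (λ v → ind-cong (inClass-reflects (toℕ k) redirect v) (λ (inj , A) →
                 let A′ , e = agree-redirect⇒ k<τk k<a below A in
                 ≈-trans (prodBelow-suc _ k) (*-congʳ (reflexive (chosen-local inj A′ e))))) ⟩
          ΣL (allVecs n n) (λ v → ind (inClass (toℕ k) redirect v) (chosen a * weight (toℕ k) (lookup v)))
            ≈⟨ ΣL-cong (allVecs n n) (λ v → ind-*ˡ (chosen a) (inClass (toℕ k) redirect v) _) ⟩
          ΣL (allVecs n n) (λ v → chosen a * ind (inClass (toℕ k) redirect v) (weight (toℕ k) (lookup v)))
            ≈⟨ ΣL-*ˡ (allVecs n n) (chosen a) ⟩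
          chosen a * classSum (toℕ k) redirect
            ≈⟨ *-congˡ (ih redirect redirect-injective) ⟩
          chosen a * prodBelow (toℕ k) (averaged redirect)
            -- `redirect` lies in its own class, hence in that of `τ`, so the averaged factors are
            -- the same.
            ≈⟨ *-congˡ (prodBelow-cong (toℕ k) λ i → reflexive (averaged-≡ redirect-injective injτ
                 (proj₁ (agree-redirect⇒ k<τk k<a below (agree-refl redirect))) i)) ⟩
          chosen a * prodBelow (toℕ k) (averaged τ) ∎
          where
          open Redirect τ injτ k a
          k<a : k < a
          k<a = ℕₚ.≰⇒> a≰k
          below : ∀ {j} → τ j ≡ a → j ≤ k
          below {j} e = subst (_≤ k) (trans (cong inv (sym e)) (inv-σ j)) low
          same : ∀ v → does (a ≟ lookup v k) ∧ (inClass (suc (toℕ k)) τ v) ≡ inClass (toℕ k) redirect v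
          same v = reflects-≡
            (proof (a ≟ lookup v k) ×-reflects inClass-reflects (suc (toℕ k)) τ v) (inClass-reflects (toℕ k) redirect v)
            (λ (e , inj , A) → inj , agree-redirect⇐ k<τk k<a below inj A (sym e))
            (λ (inj , A) → let A′ , e = agree-redirect⇒ k<τk k<a below A in sym e , inj , A′)

        classSum-suc-excedance : classSum (suc (toℕ k)) τ ≈ prodBelow (suc (toℕ k)) (averaged τ)
        classSum-suc-excedance = begin
          classSum (suc (toℕ k)) τ
            -- Each term is split by the value at `k`, so that the sum over that value can be moved
            -- outside.
            ≈⟨ ΣL-cong (allVecs n n) (λ v → ≈-sym (sum-≡-ind (lookup v k) _)) ⟩
          ΣL (allVecs n n) (λ v → sum (λ a → summand a v))
            ≈⟨ ΣL-sum (allVecs n n) (λ v a → summand a v) ⟩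
          sum (λ a → ΣL (allVecs n n) (summand a))
            ≈⟨ Sum.sum-cong-≋ {n} sum-at ⟩
          sum (λ a → ind (available a) (chosen a * prodBelow (toℕ k) (averaged τ)))
            ≈⟨ Sum.sum-cong-≋ {n} (λ a → ind-*ʳ (available a) (chosen a) _) ⟩
          sum (λ a → ind (available a) (chosen a) * prodBelow (toℕ k) (averaged τ))
            ≈⟨ Sum.*-distribʳ-sum _ (λ a → ind (available a) (chosen a)) ⟨
          sum (λ a → ind (available a) (chosen a)) * prodBelow (toℕ k) (averaged τ)
            ≈⟨ *-congʳ sum-chosen ⟩
          averaged τ k * prodBelow (toℕ k) (averaged τ)
            ≈⟨ prodBelow-suc (averaged τ) k ⟨
          prodBelow (suc (toℕ k)) (averaged τ) ∎

      classSum≈averaged : ∀ m → m ℕ.≤ n → ∀ τ → Inj τ → classSum m τ ≈ prodBelow m (averaged τ)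
      classSum≈averaged zero    _   τ injτ = ≈-trans (classSum-zero τ injτ) (≈-sym (prodBelow-zero (averaged τ)))
      classSum≈averaged (suc m) m<n τ injτ =
        -- The two step lemmas speak of a position `k` and the level `toℕ k`, which equals `m` only
        -- propositionally.
        subst (λ l → (∀ τ → Inj τ → classSum l τ ≈ prodBelow l (averaged τ)) →
                     classSum (suc l) τ ≈ prodBelow (suc l) (averaged τ))
          (toℕ-fromℕ< m<n) advance (classSum≈averaged m (ℕₚ.<⇒≤ m<n))
        where
        k : Fin n
        k = fromℕ< m<n
        advance : (∀ τ → Inj τ → classSum (toℕ k) τ ≈ prodBelow (toℕ k) (averaged τ)) →
          classSum (suc (toℕ k)) τ ≈ prodBelow (suc (toℕ k)) (averaged τ)
        advance ih with k Fin.<? τ k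
        ... | yes k<τk = ExcedanceStep.classSum-suc-excedance τ injτ k k<τk ih
        ... | no k≮τk  = classSum-suc-nonexcedance τ injτ k (ℕₚ.≮⇒≥ k≮τk) (ih τ injτ)

    -- Comparison of the two polynomials

    ΣL-perms : ∀ {n} (f : (Fin n → Fin n) → Carrier) {g : Vec (Fin n) n → Carrier} →
      (∀ v → Inj (lookup v) → f (lookup v) ≈ g v) → ΣL (perms n) f ≈ ΣL (filterᵇ isInjective (allVecs n n)) g
    ΣL-perms {n} f h = ≈-trans (ΣL-map lookup (filterᵇ isInjective (allVecs n n)))
      (≈-trans (ΣL-filter (T? ∘ isInjective) (allVecs n n))
      (≈-trans (ΣL-cong (allVecs n n) λ v → ind-cong (isInjective-reflects v) (h v))
      (≈-sym (ΣL-filter (T? ∘ isInjective) (allVecs n n)))))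

    -- On each class at level n the sum is the product of the averaged factors, in which the
    -- statistic no longer occurs. So any two statistics with the unique choice property give the
    -- same total.
    weightSum≈ : ∀ n {sp sp′ : ∀ {n} → (Fin n → Fin n) → Fin n → Bool} → UniqueChoice sp → UniqueChoice sp′ →
      ΣL (filterᵇ isInjective (allVecs n n)) (λ v → prod (local (lookup v) (sp (lookup v)))) ≈
      ΣL (filterᵇ isInjective (allVecs n n)) (λ v → prod (local (lookup v) (sp′ (lookup v))))
    weightSum≈ n {sp} {sp′} unique unique′ =
      ΣL-by-classes (λ v u → agree? n (lookup v) (lookup u)) (λ v → agree-refl (lookup v)) agree-sym agree-trans
        (filterᵇ isInjective (allVecs n n)) λ u u∈ →
          let injective = inj-of u (proj₂ (∈-filter⁻ (T? ∘ isInjective) {xs = allVecs n n} u∈)) in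
          ≈-trans (class sp unique u injective) (≈-sym (class sp′ unique′ u injective))
      where
      inj-of : ∀ v → T (isInjective v) → Inj (lookup v)
      inj-of v t with isInjective v | isInjective-reflects v
      ... | true | ofʸ inj = inj

      class : ∀ (sp : ∀ {n} → (Fin n → Fin n) → Fin n → Bool) → UniqueChoice sp → ∀ u → Inj (lookup u) →
        ΣL (filterᵇ isInjective (allVecs n n))
          (λ v → ind (does (agree? n (lookup v) (lookup u))) (prod (local (lookup v) (sp (lookup v))))) ≈
        prodBelow n (averaged (lookup u))
      class sp unique u inj = begin
        ΣL (filterᵇ isInjective (allVecs n n))
          (λ v → ind (does (agree? n (lookup v) (lookup u))) (prod (local (lookup v) (sp (lookup v)))))
          ≈⟨ ΣL-filter (T? ∘ isInjective) (allVecs n n) ⟩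
        ΣL (allVecs n n)
          (λ v → ind (isInjective v) (ind (does (agree? n (lookup v) (lookup u))) (prod (local (lookup v) (sp (lookup v))))))
          ≈⟨ ΣL-cong (allVecs n n) (λ v → ≈-trans (ind-∧ (isInjective v) (does (agree? n (lookup v) (lookup u))) _)
               (ind-cong (inClass-reflects n (lookup u) v)
                 λ _ → ≈-sym (prodBelow-all (local (lookup v) (sp (lookup v)))))) ⟩
        classSum n (lookup u)
          ≈⟨ classSum≈averaged n ℕₚ.≤-refl (lookup u) inj ⟩
        prodBelow n (averaged (lookup u)) ∎
        where open ClassSum sp unique

theorem3 : ∀ {c ℓ} (R : CommutativeSemiring c ℓ) →
    let open CommutativeSemiring R in
    (n : ℕ) (x₁ x₂ y₁ y₂ u₁ u₂ v₁ v₂ : Carrier) (w : ℕ → Carrier) →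
    Poly.Qtilde R n x₁ x₂ y₁ y₂ u₁ u₂ v₁ v₂ w ≈ Poly.Q1 R n x₁ x₂ y₁ y₂ u₁ u₂ v₁ v₂ w
theorem3 R n x₁ x₂ y₁ y₂ u₁ u₂ v₁ v₂ w = begin
  Poly.Qtilde R n x₁ x₂ y₁ y₂ u₁ u₂ v₁ v₂ w
    ≈⟨ ΣL-perms _ (λ v inj → let open Stats (lookup v) in
         ≈-trans (term-prod (lookup v) cycMin (not ∘ cycMin))
           (Prod.sum-cong-≋ R {n} (factor-local (lookup v) inj cycMin cycMin (not ∘ cycMin) λ _ _ → refl , refl))) ⟩
  ΣL R (filterᵇ isInjective (allVecs n n)) (λ v → Prod.sum R (local (lookup v) (cycMinOrRecord (lookup v))))
    ≈⟨ weightSum≈ n cycMin-uniqueChoice record-uniqueChoice ⟩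
  ΣL R (filterᵇ isInjective (allVecs n n)) (λ v → Prod.sum R (local (lookup v) (Stats.isRec (lookup v))))
    ≈⟨ ΣL-perms _ (λ v inj → let open Stats (lookup v) in
         ≈-trans (term-prod (lookup v) erec nra)
           (Prod.sum-cong-≋ R {n} λ i → ≈-trans (factor-local (lookup v) inj isRec erec nra (exclusive v inj) i)
             -- Here valleys and double rises are both read through records, so the case distinction
             -- on `preAbove` collapses.
             (reflexive (cong (λ b → if ltF i (lookup v i) then (if b then special (lookup v) i else plain (lookup v) i)
                                                          else base (lookup v) i)
               (if-eta (preAbove i)))))) ⟨
  Poly.Q1 R n x₁ x₂ y₁ y₂ u₁ u₂ v₁ v₂ w ∎
  where
  open CommutativeSemiring R hiding (zero) renaming (refl to ≈-refl; sym to ≈-sym; trans to ≈-trans)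
  open Relation.Binary.Reasoning.Setoid setoid
  open Weights R x₁ x₂ y₁ y₂ u₁ u₂ v₁ v₂ w

  exclusive : ∀ v → Inj (lookup v) → ∀ i → i < lookup v i →
    Stats.erec (lookup v) i ≡ Stats.isRec (lookup v) i × Stats.nra (lookup v) i ≡ not (Stats.isRec (lookup v) i)
  exclusive v inj i exc
    rewrite reflects-false (isArec-reflects (lookup v) i) (Bijection.excedance-not-antirecord (lookup v) inj i exc)
    = ∧-identityʳ _ , ∧-identityʳ _
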